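{- Let $p$ be a prime. Then for positive integers $r, a_1, b_1, \ldots, a_r, b_r$, $$S_{p-1}^q\Bigl(\overset{r-1}{\underset{j=1}{\mathbf{Cat}}}\{\{1\}^{a_j-1}, b_j+1\},\, \{1\}^{a_r-1},\, b_r\Bigr)\equiv (-1)^{a_1+b_1+\cdots+a_r+b_r}\,S_{p-1}^q\Bigl(\overset{r-1}{\underset{j=1}{\mathbf{Cat}}}\{\{1\}^{b_{r-j+1}-1}, a_{r-j+1}+1\},\, \{1\}^{b_1-1},\, a_1\Bigr) \pmod{[p]_q}.$$
   Context: Here $q$ is an indeterminate and $[n]_q=\frac{1-q^n}{1-q}=1+q+\cdots+q^{n-1}$. For positive integers $s_1,\dots,s_l$, $$S_n^q(s_1,\ldots,s_l)=\sum_{1\le k_1\le\cdots\le k_l\le n}\prod_{i=1}^l\frac{q^{(s_i-1)k_i}}{[k_i]_q^{s_i}}.$$ $\{s\}^t$ denotes $t\ge0$ consecutive copies of $s$. $\mathbf{Cat}_{j=1}^{m}\{\mathbf{s}_j\}$ denotes the concatenated argument sequence $\mathbf{s}_1,\ldots,\mathbf{s}_m$ (empty if $m=0$). For instance, the argument on the left is $\{1\}^{a_1-1},b_1+1,\{1\}^{a_2-1},b_2+1,\ldots,\{1\}^{a_{r-1}-1},b_{r-1}+1,\{1\}^{a_r-1},b_r$, and on the right it is $\{1\}^{b_r-1},a_r+1,\{1\}^{b_{r-1}-1},a_{r-1}+1,\ldots,\{1\}^{b_2-1},a_2+1,\{1\}^{b_1-1},a_1$. For a prime $p$ and rational functions $A,B$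 in $q$, $A\equiv B\pmod{[p]_q}$ means $A-B=f/g$ with $f,g$ polynomials in $q$ with integer coefficients, $g$ coprime to $[p]_q$ in $\mathbb{Q}[q]$, and $[p]_q\mid f$ ($[p]_q$ is the $p$th cyclotomic polynomial, irreducible over $\mathbb{Q}$). -}

module Defs where

open import Algebra.Bundles using (RawRing)
open import Data.Fin.Base as Fin using (Fin; toℕ; inject₁; fromℕ)
import Data.Fin.Properties as Fin
open import Data.Integer.Base as ℤ using (0ℤ; 1ℤ)
import Data.Integer.Properties as ℤ
open import Data.List.Base as List using (List; []; _∷_; [_]; _++_; length; lookup)
open import Data.Nat.Base as ℕ using (ℕ; zero; suc; _∸_)
import Data.Rational.Base as ℚ
import Data.Rational.Literals as ℚ
open import Data.Sum.Base as Sum using (_⊎_; inj₁; inj₂; [_,_])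
open import Data.Vec.Base as Vec using (Vec; []; _∷_)
open import Data.Vec.Functional using (Vector)
open import Data.Vec.Relation.Unary.Linked using (linked?)
open import Level using (0ℓ)
open import Relation.Binary.PropositionalEquality
  using (_≡_; refl; sym; trans; cong; module ≡-Reasoning)
import Algebra.Definitions.RawSemiring as RawSemiringDefs

-- A polynomial in q is its list of coefficients, constant term first.
-- Trailing zeros are allowed, so equality is equality of all coefficients.

module Polynomial {c ℓ} (R : RawRing c ℓ) where
  open RawRing R

  Poly : Set c
  Poly = List Carrier

  coeff : Poly → ℕ → Carrier
  coeff []      _       = 0#
  coeff (x ∷ _) zero    = x
  coeff (_ ∷ f) (suc n) = coeff f n

  infix 4 _≈ₚ_
  infixl 6 _+ₚ_
  infixl 7 _·ₚ_ _*ₚ_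

  _≈ₚ_ : Poly → Poly → Set ℓ
  f ≈ₚ g = ∀ n → coeff f n ≈ coeff g n

  _+ₚ_ : Poly → Poly → Poly
  []      +ₚ g       = g
  (x ∷ f) +ₚ []      = x ∷ f
  (x ∷ f) +ₚ (y ∷ g) = (x + y) ∷ (f +ₚ g)

  _·ₚ_ : Carrier → Poly → Poly
  x ·ₚ f = List.map (x *_) f

  _*ₚ_ : Poly → Poly → Poly
  []      *ₚ g = []
  (x ∷ f) *ₚ g = (x ·ₚ g) +ₚ (0# ∷ (f *ₚ g))

  rawRing : RawRing c ℓ
  rawRing = record
    { Carrier = Poly
    ; _≈_     = _≈ₚ_
    ; _+_     = _+ₚ_
    ; _*_     = _*ₚ_
    ; -_      = List.map -_
    ; 0#      = []
    ; 1#      = [ 1# ]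
    }

ℤ[q] ℚ[q] : RawRing 0ℓ 0ℓ
ℤ[q] = Polynomial.rawRing ℤ.+-*-rawRing
ℚ[q] = Polynomial.rawRing ℚ.+-*-rawRing

module ℤ[q] where
  open Polynomial ℤ.+-*-rawRing public using (coeff)
  open RawRing ℤ[q] public
  open RawSemiringDefs (RawRing.rawSemiring ℤ[q]) public using (_^_; _∣_)

module ℚ[q] where
  open RawRing ℚ[q] public
  open RawSemiringDefs (RawRing.rawSemiring ℚ[q]) public using (_∣_; Coprime)

toℚ[q] : ℤ[q].Carrier → ℚ[q].Carrier
toℚ[q] = List.map ℚ.fromℤ

q : ℤ[q].Carrier
q = 0ℤ ∷ 1ℤ ∷ []

-- [n]_q = 1 + q + ⋯ + qⁿ⁻¹

[_]q : ℕ → ℤ[q].Carrier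
[ n ]q = List.replicate n 1ℤ

-- Denominators must be non-zero, so ℤ[q] is shown to have no zero divisors.

module _ where
  open ℤ[q]
  open ≡-Reasoning

  coeff-+ : ∀ f g n → coeff (f + g) n ≡ coeff f n ℤ.+ coeff g n
  coeff-+ []      g       n       = sym (ℤ.+-identityˡ _)
  coeff-+ (x ∷ f) []      n       = sym (ℤ.+-identityʳ _)
  coeff-+ (x ∷ f) (y ∷ g) zero    = refl
  coeff-+ (x ∷ f) (y ∷ g) (suc n) = coeff-+ f g n

  coeff-· : ∀ x f n → coeff (List.map (x ℤ.*_) f) n ≡ x ℤ.* coeff f n
  coeff-· x []      n       = sym (ℤ.*-zeroʳ x)
  coeff-· x (y ∷ f) zero    = refl
  coeff-· x (y ∷ f) (suc n) = coeff-· x f n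

  coeff-∷* : ∀ x f g n → coeff ((x ∷ f) * g) n ≡ x ℤ.* coeff g n ℤ.+ coeff (0ℤ ∷ f * g) n
  coeff-∷* x f g n = trans (coeff-+ (List.map (x ℤ.*_) g) (0ℤ ∷ f * g) n)
                           (cong (λ c → c ℤ.+ coeff (0ℤ ∷ f * g) n) (coeff-· x g n))

  0∷*≈ : ∀ {x} f g → x ≡ 0ℤ → (x ∷ f) * g ≈ 0ℤ ∷ f * g
  0∷*≈ f g refl n = trans (coeff-∷* 0ℤ f g n) (ℤ.+-identityˡ _)

  *0∷≈ : ∀ {y} f g → y ≡ 0ℤ → f * (y ∷ g) ≈ 0ℤ ∷ f * g
  *0∷≈ []      g refl zero    = refl
  *0∷≈ []      g refl (suc n) = refl
  *0∷≈ (x ∷ f) g refl zero    = trans (ℤ.+-identityʳ _) (ℤ.*-zeroʳ x)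
  *0∷≈ (x ∷ f) g refl (suc n) = begin
    coeff ((x ∷ f) * (0ℤ ∷ g)) (suc n)          ≡⟨ coeff-∷* x f (0ℤ ∷ g) (suc n) ⟩
    x ℤ.* coeff g n ℤ.+ coeff (f * (0ℤ ∷ g)) n  ≡⟨ cong (λ c → x ℤ.* coeff g n ℤ.+ c) (*0∷≈ f g refl n) ⟩
    x ℤ.* coeff g n ℤ.+ coeff (0ℤ ∷ f * g) n    ≡⟨ coeff-∷* x f g n ⟨
    coeff ((x ∷ f) * g) n                       ∎

  0∷≈0 : ∀ {x f} → x ≡ 0ℤ → f ≈ 0# → x ∷ f ≈ 0#
  0∷≈0 x≡0 f≈0 zero    = x≡0
  0∷≈0 x≡0 f≈0 (suc n) = f≈0 n

  f*g≈0⇒f≈0∨g≈0 : ∀ f g → f * g ≈ 0# → f ≈ 0# ⊎ g ≈ 0#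
  f*g≈0⇒f≈0∨g≈0 []      g       _    = inj₁ (λ _ → refl)
  f*g≈0⇒f≈0∨g≈0 (x ∷ f) []      _    = inj₂ (λ _ → refl)
  f*g≈0⇒f≈0∨g≈0 (x ∷ f) (y ∷ g) fg≈0 =
    [ (λ x≡0 → Sum.map₁ (0∷≈0 x≡0) (f*g≈0⇒f≈0∨g≈0 f (y ∷ g)
        (λ n → trans (sym (0∷*≈ f (y ∷ g) x≡0 (suc n))) (fg≈0 (suc n)))))
    , (λ y≡0 → Sum.map₂ (0∷≈0 y≡0) (f*g≈0⇒f≈0∨g≈0 (x ∷ f) g
        (λ n → trans (sym (*0∷≈ (x ∷ f) g y≡0 (suc n))) (fg≈0 (suc n)))))
    ] (ℤ.i*j≡0⇒i≡0∨j≡0 x (trans (sym (ℤ.+-identityʳ _)) (fg≈0 0)))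

  *-≉0 : ∀ {f g} → f ≉ 0# → g ≉ 0# → f * g ≉ 0#
  *-≉0 {f} {g} f≉0 g≉0 fg≈0 = [ f≉0 , g≉0 ] (f*g≈0⇒f≈0∨g≈0 f g fg≈0)

  1≉0 : 1# ≉ 0#
  1≉0 1≈0 with () ← 1≈0 0

  ^-≉0 : ∀ {f} n → f ≉ 0# → f ^ n ≉ 0#
  ^-≉0         zero    f≉0 = 1≉0
  ^-≉0 {f = f} (suc n) f≉0 = *-≉0 {f} {f ^ n} f≉0 (^-≉0 {f} n f≉0)

  [1+n]q≉0 : ∀ n → [ suc n ]q ≉ 0#
  [1+n]q≉0 n [1+n]≈0 with () ← [1+n]≈0 0

-- ℚ(q), as the field of fractions of ℤ[q]

record RatFun : Set where
  constructor frac
  field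
    num   : ℤ[q].Carrier
    den   : ℤ[q].Carrier
    den≉0 : den ℤ[q].≉ ℤ[q].0#

ℚ⟨q⟩ : RawRing 0ℓ 0ℓ
ℚ⟨q⟩ = record
  { Carrier = RatFun
  ; _≈_     = λ (frac f g _) (frac f′ g′ _) → f * g′ ≈ f′ * g
  ; _+_     = λ (frac f g g≉0) (frac f′ g′ g′≉0) →
                frac (f * g′ + f′ * g) (g * g′) (*-≉0 {g} {g′} g≉0 g′≉0)
  ; _*_     = λ (frac f g g≉0) (frac f′ g′ g′≉0) →
                frac (f * f′) (g * g′) (*-≉0 {g} {g′} g≉0 g′≉0)
  ; -_      = λ (frac f g g≉0) → frac (- f) g g≉0
  ; 0#      = frac 0# 1# 1≉0
  ; 1#      = frac 1# 1# 1≉0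
  }
  where open ℤ[q]

module ℚ⟨q⟩ where
  open RawRing ℚ⟨q⟩ public
  open RawSemiringDefs (RawRing.rawSemiring ℚ⟨q⟩) public using (_^_; product)

-- Coprimality is taken in ℚ[q], divisibility in ℤ[q]; for monic h, such as
-- [ p ]q, the latter agrees with divisibility in ℚ[q].

infix 4 _≡_[mod_]

record _≡_[mod_] (A B : RatFun) (h : ℤ[q].Carrier) : Set where
  field
    f/g        : RatFun
    difference : A ℚ⟨q⟩.+ (ℚ⟨q⟩.- B) ℚ⟨q⟩.≈ f/g
    coprime    : ℚ[q].Coprime (toℚ[q] (RatFun.den f/g)) (toℚ[q] h)
    divides    : h ℤ[q].∣ RatFun.num f/g

-- An index 1 ≤ k ≤ n is encoded as the element k - 1 of Fin n.

index : ∀ {n} → Fin n → ℕ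
index k = suc (toℕ k)

-- q^((s-1)k) / [k]_q^s; meaningful for s ≥ 1 only.

term : ∀ {n} → ℕ → Fin n → RatFun
term s k = frac (q ^ ((s ∸ 1) ℕ.* index k)) ([ index k ]q ^ s)
                (^-≉0 {[ index k ]q} s ([1+n]q≉0 (toℕ k)))
  where open ℤ[q]

tuples : ∀ n l → List (Vec (Fin n) l)
tuples n zero    = [ [] ]
tuples n (suc l) = List.cartesianProductWith _∷_ (List.allFin n) (tuples n l)

increasingTuples : ∀ n l → List (Vec (Fin n) l)
increasingTuples n l = List.filter (linked? Fin._≤?_) (tuples n l)

S : ℕ → List ℕ → RatFun
S n s = List.foldr _+_ 0# (List.map summand (increasingTuples n (length s)))
  where
  open ℚ⟨q⟩
  summand : Vec (Fin n) (length s) → RatFun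
  summand k = product λ i → term (lookup s i) (Vec.lookup k i)

-- With r = m + 1:
-- {1}^(a₁-1), b₁+1, …, {1}^(a_{r-1}-1), b_{r-1}+1, {1}^(a_r-1), b_r

arguments : ∀ {m} → Vector ℕ (suc m) → Vector ℕ (suc m) → List ℕ
arguments {m} a b =
  List.concat (List.tabulate λ (j : Fin m) →
    List.replicate (a (inject₁ j) ∸ 1) 1 ++ [ b (inject₁ j) ℕ.+ 1 ])
  ++ List.replicate (a (fromℕ m) ∸ 1) 1 ++ [ b (fromℕ m) ]

{-# OPTIONS --safe #-}
module Submission where

-- Modulo [p]_q every [k]_q with 0 < k < p is invertible, so both sides live in
-- the ring ℤ[q]/[p]_q.  On vectors indexed by 1 ≤ k < p let A be multiplication
-- by α_k = q^k/[k]_q and (D v)_j = ∑_{k ≥ j} v_k/[k]_q.  With β_k = 1/[k]_q and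
-- 𝟏 = (1, …, 1), the sum S(s₁, s₂, …) is ⟨β, W 𝟏⟩ where D W is the product
-- D A^(s₁-1) D A^(s₂-1) ⋯.  The symmetric matrix
--   C_ij = q^(-ij) [i+j-1]_q! / ([i-1]_q! [j-1]_q!)
-- vanishes for i + j > p and satisfies β_j C_ij = α_i (C_i,j+1 - C_ij).  Telescoping
-- gives A C = - C Dᵀ, D C = - C A and C β = - 𝟏, so moving C through W exchanges
-- A and D and reverses their order:
--   ⟨β, W 𝟏⟩ = ± ⟨β, W′ 𝟏⟩.
-- For the arguments on the left D W A = D^a₁ A^b₁ ⋯ D^a_r A^b_r, and D W′ A is the
-- corresponding word D^b_r A^a_r ⋯ D^b₁ A^a₁ for the arguments on the right.

open import Defs
open import Algebra.Bundles using (CommutativeRing; CommutativeSemiring; Semiring)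
open import Data.Bool.Base using (true; false; _∧_; if_then_else_)
open import Data.Fin.Base as Fin using (Fin; zero; suc; toℕ; inject₁; fromℕ; opposite)
import Data.Fin.Properties as Fin
open import Data.Integer.Base as ℤ using (0ℤ; 1ℤ)
import Data.Integer.Properties as ℤ
open import Data.List.Base as List using (List; []; _∷_; [_]; _++_; length)
import Data.List.Properties as List
open import Data.List.Relation.Unary.All using (All; []; _∷_)
import Data.List.Relation.Unary.All.Properties as All
open import Data.Nat.Base as ℕ using (ℕ; zero; suc; _∸_; NonZero; z≤n; s≤s; +-0-rawMonoid)
open import Data.Nat.Coprimality as Coprimality using (Coprime; coprime-Bézout; prime⇒coprime)
open import Data.Nat.GCD using (module Bézout)
open import Data.Nat.Primality using (Prime; ¬prime[0])
import Data.Nat.Properties as ℕ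
open import Data.Product.Base using (_,_; _×_; ∃; proj₁; proj₂)
import Data.Rational.Base as ℚ
import Data.Rational.Literals as ℚ
import Data.Rational.Properties as ℚ
import Data.Rational.Unnormalised.Base as ℚᵘ
import Data.Rational.Unnormalised.Properties as ℚᵘ
open import Data.Vec.Base as Vec using (Vec; []; _∷_)
open import Data.Vec.Functional using (Vector; reverse; tail; init; last)
open import Data.Vec.Relation.Unary.Linked using (linked?)
open import Function.Base using (_∘_; id)
import Level
open import Relation.Binary.PropositionalEquality as ≡ using (_≡_; _≗_)
open import Relation.Nullary.Decidable using (does; yes; no)
open import Relation.Nullary.Negation using (contradiction)
open import Relation.Unary using (Pred; Decidable)
open import Algebra.Definitions.RawMonoid +-0-rawMonoid using (sum)
import Algebra.Definitions.RawMagma as RawMagmaDefs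
import Algebra.Definitions.RawSemiring as RawSemiringDefs
import Algebra.Properties.CommutativeSemiring.Exp as Exp
import Algebra.Properties.Group as GroupProperties
import Algebra.Properties.Ring as RingProperties
import Algebra.Properties.Semiring.Sum as SemiringSum
import Algebra.Solver.Ring.NaturalCoefficients.Default as SemiringSolver
import Relation.Binary.Reasoning.Setoid as SetoidReasoning

-- Coefficient lists as a commutative ring, over any commutative ring (later ℤ and ℚ).

module _ {c ℓ} (R : CommutativeRing c ℓ) where
  open CommutativeRing R hiding (_-_)
  open RingProperties ring using (-0#≈0#)
  open Polynomial rawRing hiding (rawRing)
  open SemiringSolver commutativeSemiring using (solve; _:+_; _:*_; _:=_)
  open SetoidReasoning setoid

  private
    shift : Poly → Poly
    shift f = 0# ∷ f

    coeff-+ₚ : ∀ f g n → coeff (f +ₚ g) n ≈ coeff f n + coeff g n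
    coeff-+ₚ []      g       n       = sym (+-identityˡ _)
    coeff-+ₚ (x ∷ f) []      n       = sym (+-identityʳ _)
    coeff-+ₚ (x ∷ f) (y ∷ g) zero    = refl
    coeff-+ₚ (x ∷ f) (y ∷ g) (suc n) = coeff-+ₚ f g n

    coeff-·ₚ : ∀ x f n → coeff (x ·ₚ f) n ≈ x * coeff f n
    coeff-·ₚ x []      n       = sym (zeroʳ x)
    coeff-·ₚ x (y ∷ f) zero    = refl
    coeff-·ₚ x (y ∷ f) (suc n) = coeff-·ₚ x f n

    coeff-neg : ∀ f n → coeff (List.map -_ f) n ≈ - coeff f n
    coeff-neg []      n       = sym -0#≈0#
    coeff-neg (x ∷ f) zero    = refl
    coeff-neg (x ∷ f) (suc n) = coeff-neg f n

    coeff-∷*ₚ : ∀ x f g n → coeff ((x ∷ f) *ₚ g) n ≈ x * coeff g n + coeff (shift (f *ₚ g)) n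
    coeff-∷*ₚ x f g n = trans (coeff-+ₚ (x ·ₚ g) (shift (f *ₚ g)) n) (+-congʳ (coeff-·ₚ x g n))

    shift-cong : ∀ {f g} → f ≈ₚ g → shift f ≈ₚ shift g
    shift-cong f≈g zero    = refl
    shift-cong f≈g (suc n) = f≈g n

    shift-+ₚ : ∀ f g → shift (f +ₚ g) ≈ₚ shift f +ₚ shift g
    shift-+ₚ f g zero    = sym (+-identityˡ _)
    shift-+ₚ f g (suc n) = refl

    shift-·ₚ : ∀ x f n → coeff (shift (x ·ₚ f)) n ≈ x * coeff (shift f) n
    shift-·ₚ x f zero    = sym (zeroʳ x)
    shift-·ₚ x f (suc n) = coeff-·ₚ x f n

    +ₚ-cong : ∀ {f f′ g g′} → f ≈ₚ f′ → g ≈ₚ g′ → f +ₚ g ≈ₚ f′ +ₚ g′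
    +ₚ-cong {f} {f′} {g} {g′} f≈f′ g≈g′ n =
      trans (coeff-+ₚ f g n) (trans (+-cong (f≈f′ n) (g≈g′ n)) (sym (coeff-+ₚ f′ g′ n)))

    *ₚ-congˡ : ∀ f {g g′} → g ≈ₚ g′ → f *ₚ g ≈ₚ f *ₚ g′
    *ₚ-congˡ []      g≈g′ n = refl
    *ₚ-congˡ (x ∷ f) {g} {g′} g≈g′ n = begin
      coeff ((x ∷ f) *ₚ g) n                     ≈⟨ coeff-∷*ₚ x f g n ⟩
      x * coeff g n + coeff (shift (f *ₚ g)) n
        ≈⟨ +-cong (*-congˡ (g≈g′ n)) (shift-cong {f *ₚ g} {f *ₚ g′} (*ₚ-congˡ f g≈g′) n) ⟩
      x * coeff g′ n + coeff (shift (f *ₚ g′)) n ≈⟨ coeff-∷*ₚ x f g′ n ⟨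
      coeff ((x ∷ f) *ₚ g′) n                    ∎

    *ₚ-zeroʳ : ∀ f → f *ₚ [] ≈ₚ []
    *ₚ-zeroʳ []      n       = refl
    *ₚ-zeroʳ (x ∷ f) zero    = refl
    *ₚ-zeroʳ (x ∷ f) (suc n) = *ₚ-zeroʳ f n

    -- Counterpart of `coeff-∷*ₚ` for the second factor; comparing the two reduces commutativity to
    -- an induction on one factor.
    *ₚ-∷ : ∀ f y g n → coeff (f *ₚ (y ∷ g)) n ≈ y * coeff f n + coeff (shift (f *ₚ g)) n
    *ₚ-∷ []      y g zero    = sym (trans (+-identityʳ _) (zeroʳ y))
    *ₚ-∷ []      y g (suc n) = sym (trans (+-identityʳ _) (zeroʳ y))
    *ₚ-∷ (x ∷ f) y g zero    = +-congʳ (*-comm x y)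
    *ₚ-∷ (x ∷ f) y g (suc n) = begin
      coeff ((x ∷ f) *ₚ (y ∷ g)) (suc n)
        ≈⟨ coeff-∷*ₚ x f (y ∷ g) (suc n) ⟩
      x * coeff g n + coeff (f *ₚ (y ∷ g)) n
        ≈⟨ +-congˡ (*ₚ-∷ f y g n) ⟩
      x * coeff g n + (y * coeff f n + coeff (shift (f *ₚ g)) n)
        ≈⟨ solve 3 (λ a b d → a :+ (b :+ d) := b :+ (a :+ d)) refl _ _ _ ⟩
      y * coeff f n + (x * coeff g n + coeff (shift (f *ₚ g)) n)
        ≈⟨ +-congˡ (coeff-∷*ₚ x f g n) ⟨
      y * coeff f n + coeff ((x ∷ f) *ₚ g) n ∎

    *ₚ-comm : ∀ f g → f *ₚ g ≈ₚ g *ₚ f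
    *ₚ-comm []      g n = sym (*ₚ-zeroʳ g n)
    *ₚ-comm (x ∷ f) g n = begin
      coeff ((x ∷ f) *ₚ g) n                   ≈⟨ coeff-∷*ₚ x f g n ⟩
      x * coeff g n + coeff (shift (f *ₚ g)) n
        ≈⟨ +-congˡ (shift-cong {f *ₚ g} {g *ₚ f} (*ₚ-comm f g) n) ⟩
      x * coeff g n + coeff (shift (g *ₚ f)) n ≈⟨ *ₚ-∷ g x f n ⟨
      coeff (g *ₚ (x ∷ f)) n                   ∎

    *ₚ-cong : ∀ {f f′ g g′} → f ≈ₚ f′ → g ≈ₚ g′ → f *ₚ g ≈ₚ f′ *ₚ g′
    *ₚ-cong {f} {f′} {g} {g′} f≈f′ g≈g′ n = begin
      coeff (f *ₚ g) n   ≈⟨ *ₚ-congˡ f g≈g′ n ⟩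
      coeff (f *ₚ g′) n  ≈⟨ *ₚ-comm f g′ n ⟩
      coeff (g′ *ₚ f) n  ≈⟨ *ₚ-congˡ g′ f≈f′ n ⟩
      coeff (g′ *ₚ f′) n ≈⟨ *ₚ-comm g′ f′ n ⟩
      coeff (f′ *ₚ g′) n ∎

    *ₚ-distribˡ : ∀ f g h → f *ₚ (g +ₚ h) ≈ₚ f *ₚ g +ₚ f *ₚ h
    *ₚ-distribˡ []      g h n = refl
    *ₚ-distribˡ (x ∷ f) g h n = begin
      coeff ((x ∷ f) *ₚ (g +ₚ h)) n
        ≈⟨ coeff-∷*ₚ x f (g +ₚ h) n ⟩
      x * coeff (g +ₚ h) n + coeff (shift (f *ₚ (g +ₚ h))) n
        ≈⟨ +-cong (*-congˡ (coeff-+ₚ g h n)) (trans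
             (shift-cong {f *ₚ (g +ₚ h)} {f *ₚ g +ₚ f *ₚ h} (*ₚ-distribˡ f g h) n)
             (trans (shift-+ₚ (f *ₚ g) (f *ₚ h) n) (coeff-+ₚ (shift (f *ₚ g)) (shift (f *ₚ h)) n))) ⟩
      x * (coeff g n + coeff h n) + (coeff (shift (f *ₚ g)) n + coeff (shift (f *ₚ h)) n)
        ≈⟨ solve 5 (λ x a b d e → x :* (a :+ b) :+ (d :+ e) := (x :* a :+ d) :+ (x :* b :+ e)) refl _ _ _ _ _ ⟩
      (x * coeff g n + coeff (shift (f *ₚ g)) n) + (x * coeff h n + coeff (shift (f *ₚ h)) n)
        ≈⟨ +-cong (coeff-∷*ₚ x f g n) (coeff-∷*ₚ x f h n) ⟨
      coeff ((x ∷ f) *ₚ g) n + coeff ((x ∷ f) *ₚ h) n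
        ≈⟨ coeff-+ₚ ((x ∷ f) *ₚ g) ((x ∷ f) *ₚ h) n ⟨
      coeff ((x ∷ f) *ₚ g +ₚ (x ∷ f) *ₚ h) n ∎

    *ₚ-distribʳ : ∀ f g h → (g +ₚ h) *ₚ f ≈ₚ g *ₚ f +ₚ h *ₚ f
    *ₚ-distribʳ f g h n = begin
      coeff ((g +ₚ h) *ₚ f) n       ≈⟨ *ₚ-comm (g +ₚ h) f n ⟩
      coeff (f *ₚ (g +ₚ h)) n       ≈⟨ *ₚ-distribˡ f g h n ⟩
      coeff (f *ₚ g +ₚ f *ₚ h) n
        ≈⟨ +ₚ-cong {f *ₚ g} {g *ₚ f} {f *ₚ h} {h *ₚ f} (*ₚ-comm f g) (*ₚ-comm f h) n ⟩
      coeff (g *ₚ f +ₚ h *ₚ f) n    ∎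

    ·ₚ-*ₚ : ∀ x f g n → coeff ((x ·ₚ f) *ₚ g) n ≈ x * coeff (f *ₚ g) n
    ·ₚ-*ₚ x []      g n = sym (zeroʳ x)
    ·ₚ-*ₚ x (y ∷ f) g n = begin
      coeff ((x ·ₚ (y ∷ f)) *ₚ g) n
        ≈⟨ coeff-∷*ₚ (x * y) (x ·ₚ f) g n ⟩
      x * y * coeff g n + coeff (shift ((x ·ₚ f) *ₚ g)) n
        ≈⟨ +-congˡ (trans (shift-cong {(x ·ₚ f) *ₚ g} {x ·ₚ (f *ₚ g)}
             (λ m → trans (·ₚ-*ₚ x f g m) (sym (coeff-·ₚ x (f *ₚ g) m))) n) (shift-·ₚ x (f *ₚ g) n)) ⟩
      x * y * coeff g n + x * coeff (shift (f *ₚ g)) n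
        ≈⟨ solve 4 (λ x y a b → x :* y :* a :+ x :* b := x :* (y :* a :+ b)) refl _ _ _ _ ⟩
      x * (y * coeff g n + coeff (shift (f *ₚ g)) n)
        ≈⟨ *-congˡ (coeff-∷*ₚ y f g n) ⟨
      x * coeff ((y ∷ f) *ₚ g) n ∎

    shift-*ₚ : ∀ f g → shift f *ₚ g ≈ₚ shift (f *ₚ g)
    shift-*ₚ f g n = trans (coeff-∷*ₚ 0# f g n) (trans (+-congʳ (zeroˡ _)) (+-identityˡ _))

    *ₚ-assoc : ∀ f g h → (f *ₚ g) *ₚ h ≈ₚ f *ₚ (g *ₚ h)
    *ₚ-assoc []      g h n = refl
    *ₚ-assoc (x ∷ f) g h n = begin
      coeff ((x ·ₚ g +ₚ shift (f *ₚ g)) *ₚ h) n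
        ≈⟨ *ₚ-distribʳ h (x ·ₚ g) (shift (f *ₚ g)) n ⟩
      coeff ((x ·ₚ g) *ₚ h +ₚ shift (f *ₚ g) *ₚ h) n
        ≈⟨ coeff-+ₚ ((x ·ₚ g) *ₚ h) (shift (f *ₚ g) *ₚ h) n ⟩
      coeff ((x ·ₚ g) *ₚ h) n + coeff (shift (f *ₚ g) *ₚ h) n
        ≈⟨ +-cong (·ₚ-*ₚ x g h n) (trans (shift-*ₚ (f *ₚ g) h n)
             (shift-cong {(f *ₚ g) *ₚ h} {f *ₚ (g *ₚ h)} (*ₚ-assoc f g h) n)) ⟩
      x * coeff (g *ₚ h) n + coeff (shift (f *ₚ (g *ₚ h))) n
        ≈⟨ coeff-∷*ₚ x f (g *ₚ h) n ⟨
      coeff ((x ∷ f) *ₚ (g *ₚ h)) n ∎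

    *ₚ-identityˡ : ∀ f → [ 1# ] *ₚ f ≈ₚ f
    *ₚ-identityˡ f n = trans (coeff-∷*ₚ 1# [] f n) (trans (+-cong (*-identityˡ _) (shift[] n)) (+-identityʳ _))
      where
      shift[] : ∀ n → coeff (shift []) n ≈ 0#
      shift[] zero    = refl
      shift[] (suc n) = refl

  polynomialRing : CommutativeRing c ℓ
  polynomialRing = record
    { Carrier = Poly ; _≈_ = _≈ₚ_ ; _+_ = _+ₚ_ ; _*_ = _*ₚ_ ; -_ = List.map -_ ; 0# = [] ; 1# = [ 1# ]
    ; isCommutativeRing = record
      { isRing = record
        { +-isAbelianGroup = record
          { isGroup = record
            { isMonoid = record
              { isSemigroup = record
                { isMagma = record
                  { isEquivalence = record
                    { refl = λ n → refl ; sym = λ e n → sym (e n) ; trans = λ e e′ n → trans (e n) (e′ n) }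
                  ; ∙-cong = λ {f} {f′} {g} {g′} → +ₚ-cong {f} {f′} {g} {g′}
                  }
                ; assoc = λ f g h n → begin
                    coeff ((f +ₚ g) +ₚ h) n              ≈⟨ coeff-+ₚ (f +ₚ g) h n ⟩
                    coeff (f +ₚ g) n + coeff h n         ≈⟨ +-congʳ (coeff-+ₚ f g n) ⟩
                    coeff f n + coeff g n + coeff h n    ≈⟨ +-assoc _ _ _ ⟩
                    coeff f n + (coeff g n + coeff h n)  ≈⟨ +-congˡ (coeff-+ₚ g h n) ⟨
                    coeff f n + coeff (g +ₚ h) n         ≈⟨ coeff-+ₚ f (g +ₚ h) n ⟨
                    coeff (f +ₚ (g +ₚ h)) n              ∎
                }
              ; identity = (λ f n → refl)
                         , (λ f n → trans (coeff-+ₚ f [] n) (+-identityʳ _))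
              }
            ; inverse = (λ f n → trans (coeff-+ₚ (List.map -_ f) f n)
                                       (trans (+-congʳ (coeff-neg f n)) (-‿inverseˡ _)))
                      , (λ f n → trans (coeff-+ₚ f (List.map -_ f) n)
                                       (trans (+-congˡ (coeff-neg f n)) (-‿inverseʳ _)))
            ; ⁻¹-cong = λ {f} {g} e n →
                trans (coeff-neg f n) (trans (-‿cong (e n)) (sym (coeff-neg g n)))
            }
          ; comm = λ f g n → trans (coeff-+ₚ f g n) (trans (+-comm _ _) (sym (coeff-+ₚ g f n)))
          }
        ; *-cong = λ {f} {f′} {g} {g′} → *ₚ-cong {f} {f′} {g} {g′}
        ; *-assoc = *ₚ-assoc
        ; *-identity = *ₚ-identityˡ , (λ f n → trans (*ₚ-comm f [ 1# ] n) (*ₚ-identityˡ f n))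
        ; distrib = *ₚ-distribˡ , *ₚ-distribʳ
        }
      ; *-comm = *ₚ-comm
      }
    }

-- The quotient of a commutative ring by a principal ideal.

module Quotient {c ℓ} (R : CommutativeRing c ℓ) (h : CommutativeRing.Carrier R) where
  open CommutativeRing R
  open RingProperties ring using (-‿+-comm; -‿distribˡ-*)
  open SemiringSolver commutativeSemiring using (solve; _:+_; _:*_; _:=_)
  open SetoidReasoning setoid

  infix 4 _∼_
  -- The multiplier is kept as data: at the end it is the quotient required by `divides` and the
  -- Bézout coefficient behind `coprime`.
  record _∼_ (x y : Carrier) : Set (c Level.⊔ ℓ) where
    constructor _,_
    field
      multiplier : Carrier
      difference : x ≈ y + multiplier * h

  ≈⇒∼ : ∀ {x y} → x ≈ y → x ∼ y
  ≈⇒∼ x≈y = 0# , trans x≈y (sym (trans (+-congˡ (zeroˡ h)) (+-identityʳ _)))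

  ∼-sym : ∀ {x y} → x ∼ y → y ∼ x
  ∼-sym {x} {y} (k , x≈) = - k , (begin
    y                         ≈⟨ +-identityʳ y ⟨
    y + 0#                    ≈⟨ +-congˡ (zeroˡ h) ⟨
    y + 0# * h                ≈⟨ +-congˡ (*-congʳ (-‿inverseʳ k)) ⟨
    y + (k + - k) * h         ≈⟨ solve 4 (λ y k l h → y :+ (k :+ l) :* h := y :+ k :* h :+ l :* h) refl y k (- k) h ⟩
    y + k * h + - k * h       ≈⟨ +-congʳ x≈ ⟨
    x + - k * h               ∎)

  ∼-trans : ∀ {x y z} → x ∼ y → y ∼ z → x ∼ z
  ∼-trans {x} {y} {z} (k , x≈) (l , y≈) = l + k , (begin
    x                  ≈⟨ x≈ ⟩
    y + k * h          ≈⟨ +-congʳ y≈ ⟩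
    z + l * h + k * h  ≈⟨ solve 4 (λ z l k h → z :+ l :* h :+ k :* h := z :+ (l :+ k) :* h) refl z l k h ⟩
    z + (l + k) * h    ∎)

  ∼-+-cong : ∀ {x y u v} → x ∼ y → u ∼ v → x + u ∼ y + v
  ∼-+-cong {x} {y} {u} {v} (k , x≈) (l , u≈) = k + l , (begin
    x + u                      ≈⟨ +-cong x≈ u≈ ⟩
    (y + k * h) + (v + l * h)
      ≈⟨ solve 5 (λ y k v l h → (y :+ k :* h) :+ (v :+ l :* h) := y :+ v :+ (k :+ l) :* h) refl y k v l h ⟩
    y + v + (k + l) * h        ∎)

  ∼-*-cong : ∀ {x y u v} → x ∼ y → u ∼ v → x * u ∼ y * v
  ∼-*-cong {x} {y} {u} {v} (k , x≈) (l , u≈) = k * v + y * l + k * l * h , (begin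
    x * u                      ≈⟨ *-cong x≈ u≈ ⟩
    (y + k * h) * (v + l * h)
      ≈⟨ solve 5 (λ y k v l h → (y :+ k :* h) :* (v :+ l :* h)
                              := y :* v :+ (k :* v :+ y :* l :+ k :* l :* h) :* h) refl y k v l h ⟩
    y * v + (k * v + y * l + k * l * h) * h ∎)

  ∼-neg-cong : ∀ {x y} → x ∼ y → - x ∼ - y
  ∼-neg-cong {x} {y} (k , x≈) = - k , (begin
    - x              ≈⟨ -‿cong x≈ ⟩
    - (y + k * h)    ≈⟨ -‿+-comm y (k * h) ⟨
    - y + - (k * h)  ≈⟨ +-congˡ (-‿distribˡ-* k h) ⟩
    - y + - k * h    ∎)

  quotientRing : CommutativeRing c (c Level.⊔ ℓ)
  quotientRing = record
    { Carrier = Carrier ; _≈_ = _∼_ ; _+_ = _+_ ; _*_ = _*_ ; -_ = -_ ; 0# = 0# ; 1# = 1#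
    ; isCommutativeRing = record
      { isRing = record
        { +-isAbelianGroup = record
          { isGroup = record
            { isMonoid = record
              { isSemigroup = record
                { isMagma = record
                  { isEquivalence = record { refl = ≈⇒∼ refl ; sym = ∼-sym ; trans = ∼-trans }
                  ; ∙-cong = ∼-+-cong
                  }
                ; assoc = λ x y z → ≈⇒∼ (+-assoc x y z)
                }
              ; identity = (λ x → ≈⇒∼ (+-identityˡ x)) , (λ x → ≈⇒∼ (+-identityʳ x))
              }
            ; inverse = (λ x → ≈⇒∼ (-‿inverseˡ x)) , (λ x → ≈⇒∼ (-‿inverseʳ x))
            ; ⁻¹-cong = ∼-neg-cong
            }
          ; comm = λ x y → ≈⇒∼ (+-comm x y)
          }
        ; *-cong = ∼-*-cong
        ; *-assoc = λ x y z → ≈⇒∼ (*-assoc x y z)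
        ; *-identity = (λ x → ≈⇒∼ (*-identityˡ x)) , (λ x → ≈⇒∼ (*-identityʳ x))
        ; distrib = (λ x y z → ≈⇒∼ (distribˡ x y z)) , (λ x y z → ≈⇒∼ (distribʳ x y z))
        }
      ; *-comm = λ x y → ≈⇒∼ (*-comm x y)
      }
    }

-- Words in two letters and their duality.

-- 𝕒 and 𝕕 stand for the operators A and D.
data Letter : Set where
  𝕒 𝕕 : Letter

swap : Letter → Letter
swap 𝕒 = 𝕕
swap 𝕕 = 𝕒

dual : List Letter → List Letter
dual w = List.reverse (List.map swap w)

word : List ℕ → List Letter
word []       = []
word (s ∷ ss) = 𝕕 ∷ List.replicate (s ∸ 1) 𝕒 ++ word ss

module _ where
  open ≡.≡-Reasoning

  -- The form of the words on which `dual` is transparent: it reverses the order of the blocks and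
  -- exchanges the two exponents of each.
  blocks : ∀ {m} → Vector ℕ m → Vector ℕ m → List Letter
  blocks {zero}  a b = []
  blocks {suc m} a b = (List.replicate (a zero) 𝕕 ++ List.replicate (b zero) 𝕒) ++ blocks (tail a) (tail b)

  -- Vectors are functions, and `init (reverse b)` agrees with `reverse (tail b)` only pointwise.
  blocks-cong : ∀ {m} {a a′ b b′ : Vector ℕ m} → a ≗ a′ → b ≗ b′ → blocks a b ≡ blocks a′ b′
  blocks-cong {zero}  a≗ b≗ = ≡.refl
  blocks-cong {suc m} a≗ b≗ = ≡.cong₂ _++_
    (≡.cong₂ (λ x y → List.replicate x 𝕕 ++ List.replicate y 𝕒) (a≗ zero) (b≗ zero))
    (blocks-cong (a≗ ∘ suc) (b≗ ∘ suc))

  -- Reversal turns the first block into the last one, so the recursion of `blocks` has to be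
  -- available from the other end.
  blocks-init-last : ∀ {m} (a b : Vector ℕ (suc m)) →
    blocks a b ≡ blocks (init a) (init b) ++ List.replicate (last a) 𝕕 ++ List.replicate (last b) 𝕒
  blocks-init-last {zero}  a b = List.++-identityʳ _
  blocks-init-last {suc m} a b = ≡.trans (≡.cong ((List.replicate (a zero) 𝕕 ++ List.replicate (b zero) 𝕒) ++_) (blocks-init-last (tail a) (tail b)))
    (≡.sym (List.++-assoc (List.replicate (a zero) 𝕕 ++ List.replicate (b zero) 𝕒) (blocks (init (tail a)) (init (tail b))) _))

  length-blocks : ∀ {m} (a b : Vector ℕ m) → length (blocks a b) ≡ sum (λ j → a j ℕ.+ b j)
  length-blocks {zero}  a b = ≡.refl
  length-blocks {suc m} a b = ≡.trans (List.length-++ (List.replicate (a zero) 𝕕 ++ List.replicate (b zero) 𝕒))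
    (≡.cong₂ ℕ._+_
      (≡.trans (List.length-++ (List.replicate (a zero) 𝕕))
               (≡.cong₂ ℕ._+_ (List.length-replicate (a zero)) (List.length-replicate (b zero))))
      (length-blocks (tail a) (tail b)))

  dual-++ : ∀ u v → dual (u ++ v) ≡ dual v ++ dual u
  dual-++ u v = ≡.trans (≡.cong List.reverse (List.map-++ swap u v)) (List.reverse-++ (List.map swap u) _)

  dual-replicate : ∀ m x → dual (List.replicate m x) ≡ List.replicate m (swap x)
  dual-replicate zero    x = ≡.refl
  dual-replicate (suc m) x = begin
    dual ([ x ] ++ List.replicate m x)         ≡⟨ dual-++ [ x ] (List.replicate m x) ⟩
    dual (List.replicate m x) ++ [ swap x ]    ≡⟨ ≡.cong (_++ [ swap x ]) (dual-replicate m x) ⟩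
    List.replicate m (swap x) ++ [ swap x ]    ≡⟨ snoc m ⟩
    List.replicate (suc m) (swap x)            ∎
    where
    snoc : ∀ m {y : Letter} → List.replicate m y ++ [ y ] ≡ y ∷ List.replicate m y
    snoc zero    = ≡.refl
    snoc (suc m) = ≡.cong (_ ∷_) (snoc m)

  opposite-inject₁ : ∀ {m} (i : Fin m) → opposite (inject₁ i) ≡ suc (opposite i)
  opposite-inject₁ zero    = ≡.refl
  opposite-inject₁ (suc i) = ≡.cong inject₁ (opposite-inject₁ i)

  opposite-fromℕ : ∀ m → opposite (fromℕ m) ≡ zero
  opposite-fromℕ zero    = ≡.refl
  opposite-fromℕ (suc m) = ≡.cong inject₁ (opposite-fromℕ m)

  dual-blocks : ∀ {m} (a b : Vector ℕ m) → dual (blocks a b) ≡ blocks (reverse b) (reverse a)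
  dual-blocks {zero}  a b = ≡.refl
  dual-blocks {suc m} a b = begin
    dual ((List.replicate (a zero) 𝕕 ++ List.replicate (b zero) 𝕒) ++ blocks (tail a) (tail b))
      ≡⟨ dual-++ (List.replicate (a zero) 𝕕 ++ _) _ ⟩
    dual (blocks (tail a) (tail b)) ++ dual (List.replicate (a zero) 𝕕 ++ List.replicate (b zero) 𝕒)
      ≡⟨ ≡.cong₂ _++_ (dual-blocks (tail a) (tail b))
           (≡.trans (dual-++ (List.replicate (a zero) 𝕕) _)
                    (≡.cong₂ _++_ (dual-replicate (b zero) 𝕒) (dual-replicate (a zero) 𝕕))) ⟩
    blocks (reverse (tail b)) (reverse (tail a)) ++ List.replicate (b zero) 𝕕 ++ List.replicate (a zero) 𝕒
      ≡⟨ ≡.cong₂ _++_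
           (blocks-cong (λ i → ≡.cong b (opposite-inject₁ i)) (λ i → ≡.cong a (opposite-inject₁ i)))
           (≡.cong₂ (λ x y → List.replicate x 𝕕 ++ List.replicate y 𝕒)
             (≡.cong b (opposite-fromℕ m)) (≡.cong a (opposite-fromℕ m))) ⟨
    blocks (init (reverse b)) (init (reverse a)) ++
      List.replicate (last (reverse b)) 𝕕 ++ List.replicate (last (reverse a)) 𝕒
      ≡⟨ blocks-init-last (reverse b) (reverse a) ⟨
    blocks (reverse b) (reverse a) ∎

  -- Recovers the recursion on blocks that the flat `concat` hides. `inject₁` and `fromℕ` compute on
  -- successors, so only associativity of `_++_` remains.
  arguments-suc : ∀ {m} (a b : Vector ℕ (suc (suc m))) →
    arguments a b ≡ List.replicate (a zero ∸ 1) 1 ++ b zero ℕ.+ 1 ∷ arguments (tail a) (tail b)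
  arguments-suc {m} a b = ≡.trans
    (List.++-assoc (List.replicate (a zero ∸ 1) 1 ++ [ b zero ℕ.+ 1 ])
      (List.concat (List.tabulate λ (j : Fin m) →
        List.replicate (a (suc (inject₁ j)) ∸ 1) 1 ++ [ b (suc (inject₁ j)) ℕ.+ 1 ])) _)
    (List.++-assoc (List.replicate (a zero ∸ 1) 1) [ b zero ℕ.+ 1 ] _)

  -- Each of the `a ∸ 1` ones contributes a single 𝕕, and the entry `b` supplies the last 𝕕 before
  -- its own letters 𝕒.
  word-1ᵃ : ∀ a .{{_ : NonZero a}} b s →
    word (List.replicate (a ∸ 1) 1 ++ b ∷ s) ≡ List.replicate a 𝕕 ++ List.replicate (b ∸ 1) 𝕒 ++ word s
  word-1ᵃ (suc zero)    b s = ≡.refl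
  word-1ᵃ (suc (suc a)) b s = ≡.cong (𝕕 ∷_) (word-1ᵃ (suc a) b s)

  -- The last entry is b_r where the pattern of the other blocks would have b_r + 1, so the word is
  -- one 𝕒 short of full blocks; the appended letter repairs this.
  word-arguments : ∀ {m} (a b : Vector ℕ (suc m)) → (∀ j → NonZero (a j)) → (∀ j → NonZero (b j)) →
    word (arguments a b) ++ [ 𝕒 ] ≡ blocks a b
  word-arguments {zero}  a b a≢0 b≢0 = begin
    word (List.replicate (a zero ∸ 1) 1 ++ [ b zero ]) ++ [ 𝕒 ]
      ≡⟨ ≡.cong (_++ [ 𝕒 ]) (word-1ᵃ (a zero) {{a≢0 zero}} (b zero) []) ⟩
    (List.replicate (a zero) 𝕕 ++ List.replicate (b zero ∸ 1) 𝕒 ++ []) ++ [ 𝕒 ]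
      ≡⟨ List.++-assoc (List.replicate (a zero) 𝕕) _ [ 𝕒 ] ⟩
    List.replicate (a zero) 𝕕 ++ (List.replicate (b zero ∸ 1) 𝕒 ++ []) ++ [ 𝕒 ]
      ≡⟨ ≡.cong (List.replicate (a zero) 𝕕 ++_) (snoc (b zero) {{b≢0 zero}}) ⟩
    List.replicate (a zero) 𝕕 ++ List.replicate (b zero) 𝕒
      ≡⟨ List.++-identityʳ _ ⟨
    blocks a b ∎
    where
    snoc : ∀ b .{{_ : NonZero b}} → (List.replicate (b ∸ 1) 𝕒 ++ []) ++ [ 𝕒 ] ≡ List.replicate b 𝕒
    snoc (suc zero)    = ≡.refl
    snoc (suc (suc b)) = ≡.cong (𝕒 ∷_) (snoc (suc b))
  word-arguments {suc m} a b a≢0 b≢0 = begin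
    word (arguments a b) ++ [ 𝕒 ]
      ≡⟨ ≡.cong (λ s → word s ++ [ 𝕒 ]) (arguments-suc a b) ⟩
    word (List.replicate (a zero ∸ 1) 1 ++ b zero ℕ.+ 1 ∷ s) ++ [ 𝕒 ]
      ≡⟨ ≡.cong (_++ [ 𝕒 ]) (word-1ᵃ (a zero) {{a≢0 zero}} (b zero ℕ.+ 1) s) ⟩
    (List.replicate (a zero) 𝕕 ++ List.replicate (b zero ℕ.+ 1 ∸ 1) 𝕒 ++ word s) ++ [ 𝕒 ]
      ≡⟨ ≡.cong (λ x → (List.replicate (a zero) 𝕕 ++ List.replicate x 𝕒 ++ word s) ++ [ 𝕒 ]) (ℕ.m+n∸n≡m (b zero) 1) ⟩
    (List.replicate (a zero) 𝕕 ++ List.replicate (b zero) 𝕒 ++ word s) ++ [ 𝕒 ]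
      ≡⟨ ≡.cong (_++ [ 𝕒 ]) (List.++-assoc (List.replicate (a zero) 𝕕) _ _) ⟨
    ((List.replicate (a zero) 𝕕 ++ List.replicate (b zero) 𝕒) ++ word s) ++ [ 𝕒 ]
      ≡⟨ List.++-assoc (List.replicate (a zero) 𝕕 ++ List.replicate (b zero) 𝕒) _ _ ⟩
    (List.replicate (a zero) 𝕕 ++ List.replicate (b zero) 𝕒) ++ (word s ++ [ 𝕒 ])
      ≡⟨ ≡.cong ((List.replicate (a zero) 𝕕 ++ List.replicate (b zero) 𝕒) ++_) (word-arguments (tail a) (tail b) (a≢0 ∘ suc) (b≢0 ∘ suc)) ⟩
    blocks a b ∎
    where
    s = arguments (tail a) (tail b)

  arguments-nonZero : ∀ {m} (a b : Vector ℕ (suc m)) → (∀ j → NonZero (b j)) → All NonZero (arguments a b)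
  arguments-nonZero {zero}  a b b≢0 = All.++⁺ (All.replicate⁺ (a zero ∸ 1) _) (b≢0 zero ∷ [])
  arguments-nonZero {suc m} a b b≢0 rewrite arguments-suc a b =
    All.++⁺ (All.replicate⁺ (a zero ∸ 1) _)
      (≡.subst NonZero (ℕ.+-comm 1 (b zero)) _ ∷ arguments-nonZero (tail a) (tail b) (b≢0 ∘ suc))

  -- `dual` exchanges the leading 𝕕 with the appended final 𝕒, so the word `w` between them is
  -- carried to the corresponding inner word of the other side. These two letters are the difference
  -- between the sum and the length of `w`.
  word-arguments-dual : ∀ {m} (a b : Vector ℕ (suc m)) → (∀ j → NonZero (a j)) → (∀ j → NonZero (b j)) →
    ∃ λ w → word (arguments a b) ≡ 𝕕 ∷ w
          × word (arguments (reverse b) (reverse a)) ≡ 𝕕 ∷ dual w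
          × sum (λ j → a j ℕ.+ b j) ≡ suc (suc (length w))
  word-arguments-dual {m} a b a≢0 b≢0 with arguments a b | word-arguments a b a≢0 b≢0
  -- An empty argument list would leave only the appended 𝕒, whereas the first block starts with 𝕕.
  ... | []    | []≡  with a zero | a≢0 zero
  ...   | suc _ | _ with () ← []≡
  word-arguments-dual {m} a b a≢0 b≢0 | s ∷ ss | ≡blocks =
    w , ≡.refl , List.++-cancelʳ [ 𝕒 ] _ _ eq , length≡
    where
    w = List.replicate (s ∸ 1) 𝕒 ++ word ss
    eq : word (arguments (reverse b) (reverse a)) ++ [ 𝕒 ] ≡ (𝕕 ∷ dual w) ++ [ 𝕒 ]
    eq = begin
      word (arguments (reverse b) (reverse a)) ++ [ 𝕒 ]
        ≡⟨ word-arguments (reverse b) (reverse a) (b≢0 ∘ opposite) (a≢0 ∘ opposite) ⟩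
      blocks (reverse b) (reverse a)    ≡⟨ dual-blocks a b ⟨
      dual (blocks a b)                 ≡⟨ ≡.cong dual ≡blocks ⟨
      dual ((𝕕 ∷ w) ++ [ 𝕒 ])           ≡⟨ dual-++ (𝕕 ∷ w) [ 𝕒 ] ⟩
      𝕕 ∷ dual ([ 𝕕 ] ++ w)             ≡⟨ ≡.cong (𝕕 ∷_) (dual-++ [ 𝕕 ] w) ⟩
      𝕕 ∷ dual w ++ [ 𝕒 ]               ∎
    length≡ : sum (λ j → a j ℕ.+ b j) ≡ suc (suc (length w))
    length≡ = begin
      sum (λ j → a j ℕ.+ b j)     ≡⟨ length-blocks a b ⟨
      length (blocks a b)         ≡⟨ ≡.cong length ≡blocks ⟨
      length ((𝕕 ∷ w) ++ [ 𝕒 ])   ≡⟨ List.length-++ (𝕕 ∷ w) ⟩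
      suc (length w ℕ.+ 1)        ≡⟨ ≡.cong suc (ℕ.+-comm (length w) 1) ⟩
      suc (suc (length w))        ∎

-- Finite sums, and sums over increasing tuples.

module Sums {c ℓ} (R : CommutativeSemiring c ℓ) {n : ℕ} where
  open CommutativeSemiring R
  open RawSemiringDefs rawSemiring using (product)
  module ∑ = SemiringSum semiring
  open SetoidReasoning setoid

  ∑ : Vector Carrier n → Carrier
  ∑ = ∑.sum

  ∑-cong : ∀ {u v : Vector Carrier n} → (∀ i → u i ≈ v i) → ∑ u ≈ ∑ v
  ∑-cong = ∑.sum-cong-≋

  ∑-*ˡ : ∀ x (v : Vector Carrier n) → x * ∑ v ≈ ∑ λ i → x * v i
  ∑-*ˡ = ∑.*-distribˡ-sum

  ∑-*ʳ : ∀ x (v : Vector Carrier n) → ∑ v * x ≈ ∑ λ i → v i * x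
  ∑-*ʳ = ∑.*-distribʳ-sum

  ∑-comm : ∀ (m : Fin n → Fin n → Carrier) → ∑ (λ i → ∑ λ j → m i j) ≈ ∑ λ j → ∑ λ i → m i j
  ∑-comm = ∑.∑-comm

  -- Sums over `j ≤ k` are written as masked sums over all indices, so that double sums can be
  -- interchanged freely; this needs rules for working under the mask.
  if-cong : ∀ b {x y} → x ≈ y → (if b then x else 0#) ≈ (if b then y else 0#)
  if-cong true  x≈y = x≈y
  if-cong false _   = refl

  if-*ˡ : ∀ b x y → x * (if b then y else 0#) ≈ (if b then x * y else 0#)
  if-*ˡ true  x y = refl
  if-*ˡ false x y = zeroʳ x

  listSum : ∀ {a} {X : Set a} → (X → Carrier) → List X → Carrier
  listSum f xs = List.foldr _+_ 0# (List.map f xs)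

  listSum-cong : ∀ {a} {X : Set a} {f g : X → Carrier} → (∀ x → f x ≈ g x) → ∀ xs → listSum f xs ≈ listSum g xs
  listSum-cong f≈g []       = refl
  listSum-cong f≈g (x ∷ xs) = +-cong (f≈g x) (listSum-cong f≈g xs)

  listSum-++ : ∀ {a} {X : Set a} (f : X → Carrier) xs ys → listSum f (xs ++ ys) ≈ listSum f xs + listSum f ys
  listSum-++ f []       ys = sym (+-identityˡ _)
  listSum-++ f (x ∷ xs) ys = trans (+-congˡ (listSum-++ f xs ys)) (sym (+-assoc _ _ _))

  listSum-*ˡ : ∀ {a} {X : Set a} c (f : X → Carrier) xs → listSum (λ x → c * f x) xs ≈ c * listSum f xs
  listSum-*ˡ c f []       = sym (zeroʳ c)
  listSum-*ˡ c f (x ∷ xs) = trans (+-congˡ (listSum-*ˡ c f xs)) (sym (distribˡ c _ _))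

  listSum-filter : ∀ {a p} {X : Set a} {P : Pred X p} (P? : Decidable P) (f : X → Carrier) xs →
                   listSum f (List.filter P? xs) ≈ listSum (λ x → if does (P? x) then f x else 0#) xs
  listSum-filter P? f []       = refl
  listSum-filter P? f (x ∷ xs) with does (P? x)
  ... | true  = +-congˡ (listSum-filter P? f xs)
  ... | false = trans (listSum-filter P? f xs) (sym (+-identityˡ _))

  listSum-product : ∀ {a} {X Y Z : Set a} (g : X → Y → Z) (f : Z → Carrier) xs ys →
                    listSum f (List.cartesianProductWith g xs ys) ≈
                    listSum (λ x → listSum (λ y → f (g x y)) ys) xs
  listSum-product g f []       ys = refl
  listSum-product g f (x ∷ xs) ys = trans (listSum-++ f (List.map (g x) ys) _)
    (+-cong (reflexive (≡.cong (List.foldr _+_ 0#) (≡.sym (List.map-∘ ys)))) (listSum-product g f xs ys))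

  listSum-allFin : ∀ (f : Vector Carrier n) → listSum f (List.allFin n) ≈ ∑ f
  listSum-allFin f = go f id
    where
    go : ∀ {m} {X : Set} (f : X → Carrier) (g : Fin m → X) → listSum f (List.tabulate g) ≈ ∑.sum (f ∘ g)
    go {zero}  f g = refl
    go {suc m} f g = +-congˡ (go f (g ∘ suc))

  module ChainSum (t : ℕ → Vector Carrier n) where

    summand : (s : List ℕ) → Vec (Fin n) (length s) → Carrier
    summand s k = product λ i → t (List.lookup s i) (Vec.lookup k i)

    -- Copies the shape of `S` in a commutative semiring, so that the two can be compared summand by
    -- summand.
    chainSum : List ℕ → Carrier
    chainSum s = listSum (summand s) (increasingTuples n (length s))

    -- The part of a chain sum that follows an entry `j`. Only the bound `j` has to be remembered,
    -- and this makes the sum recursive.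
    tailSum : List ℕ → Vector Carrier n
    tailSum s j = listSum (λ k → if does (linked? Fin._≤?_ (j ∷ k)) then summand s k else 0#) (tuples n (length s))

    tailSum-∷ : ∀ x s j → tailSum (x ∷ s) j ≈ ∑ λ k → if does (j Fin.≤? k) then t x k * tailSum s k else 0#
    tailSum-∷ x s j = begin
      tailSum (x ∷ s) j
        ≈⟨ listSum-product _∷_ _ (List.allFin n) (tuples n (length s)) ⟩
      -- The decision `linked?` on `j ∷ k ∷ v` computes to this conjunction.
      listSum (λ k → listSum (λ v → if does (j Fin.≤? k) ∧ does (linked? Fin._≤?_ (k ∷ v))
                                    then t x k * summand s v else 0#) (tuples n (length s))) (List.allFin n)
        ≈⟨ listSum-allFin _ ⟩
      ∑ (λ k → listSum (λ v → if does (j Fin.≤? k) ∧ does (linked? Fin._≤?_ (k ∷ v))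
                              then t x k * summand s v else 0#) (tuples n (length s)))
        ≈⟨ ∑-cong (λ k → split (does (j Fin.≤? k)) k) ⟩
      ∑ (λ k → if does (j Fin.≤? k) then t x k * tailSum s k else 0#) ∎
      where
      split : ∀ b k → listSum (λ v → if b ∧ does (linked? Fin._≤?_ (k ∷ v)) then t x k * summand s v else 0#)
                              (tuples n (length s))
                    ≈ (if b then t x k * tailSum s k else 0#)
      split true  k = trans (listSum-cong (λ v → sym (if-*ˡ (does (linked? Fin._≤?_ (k ∷ v))) (t x k) (summand s v)))
                                          (tuples n (length s)))
                            (listSum-*ˡ (t x k) _ (tuples n (length s)))
      split false k = zeros (tuples n (length s))
        where
        zeros : ∀ vs → listSum (λ _ → 0#) vs ≈ 0#
        zeros []       = refl
        zeros (_ ∷ vs) = trans (+-identityˡ _) (zeros vs)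

    chainSum-∷ : ∀ x s → chainSum (x ∷ s) ≈ ∑ λ k → t x k * tailSum s k
    chainSum-∷ x s = begin
      chainSum (x ∷ s)
        ≈⟨ listSum-filter (linked? Fin._≤?_) (summand (x ∷ s)) (tuples n (suc (length s))) ⟩
      listSum (λ k → if does (linked? Fin._≤?_ k) then summand (x ∷ s) k else 0#) (tuples n (suc (length s)))
        ≈⟨ listSum-product _∷_ _ (List.allFin n) (tuples n (length s)) ⟩
      listSum (λ k → listSum (λ v → if does (linked? Fin._≤?_ (k ∷ v))
                                    then t x k * summand s v else 0#) (tuples n (length s))) (List.allFin n)
        ≈⟨ listSum-allFin _ ⟩
      ∑ (λ k → listSum (λ v → if does (linked? Fin._≤?_ (k ∷ v))
                              then t x k * summand s v else 0#) (tuples n (length s)))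
        ≈⟨ ∑-cong (λ k → trans
             (listSum-cong (λ v → sym (if-*ˡ (does (linked? Fin._≤?_ (k ∷ v))) (t x k) (summand s v)))
                           (tuples n (length s)))
             (listSum-*ˡ (t x k) _ (tuples n (length s)))) ⟩
      ∑ (λ k → t x k * tailSum s k) ∎

-- The operators A and D, and duality under an abstract connector matrix.

module Operators {c ℓ} (R : CommutativeSemiring c ℓ) {n : ℕ}
                 (α β : Vector (CommutativeSemiring.Carrier R) n) where
  open CommutativeSemiring R
  open RawSemiringDefs rawSemiring using (_^_)
  open Sums R {n}
  open SemiringSolver R using (solve; _:+_; _:*_; _:=_)
  open SetoidReasoning setoid

  infix 4 _≋_
  _≋_ : Vector Carrier n → Vector Carrier n → Set ℓ
  u ≋ v = ∀ i → u i ≈ v i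

  infixr 7 _•_
  _•_ : Carrier → Vector Carrier n → Vector Carrier n
  (x • v) i = x * v i

  𝟏 : Vector Carrier n
  𝟏 _ = 1#

  ⟨_,_⟩ : Vector Carrier n → Vector Carrier n → Carrier
  ⟨ u , v ⟩ = ∑ λ i → u i * v i

  -- `B` is the transpose of `D` for the pairing `⟨_,_⟩`, while `A`, being diagonal, is its own
  -- transpose.
  A D B : Vector Carrier n → Vector Carrier n
  A v i = α i * v i
  D v j = ∑ λ k → if does (j Fin.≤? k) then β k * v k else 0#
  B v k = β k * ∑ λ j → if does (j Fin.≤? k) then v j else 0#

  ⟦_⟧ : List Letter → Vector Carrier n → Vector Carrier n
  ⟦ []    ⟧ v = v
  ⟦ 𝕒 ∷ w ⟧ v = A (⟦ w ⟧ v)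
  ⟦ 𝕕 ∷ w ⟧ v = D (⟦ w ⟧ v)

  -- The transpose of ⟦ dual w ⟧, see ⟨⟩-⟦⟧ᵗ.
  ⟦_⟧ᵗ : List Letter → Vector Carrier n → Vector Carrier n
  ⟦ []    ⟧ᵗ v = v
  ⟦ 𝕒 ∷ w ⟧ᵗ v = B (⟦ w ⟧ᵗ v)
  ⟦ 𝕕 ∷ w ⟧ᵗ v = A (⟦ w ⟧ᵗ v)

  ⟨⟩-cong : ∀ {u u′ v v′} → u ≋ u′ → v ≋ v′ → ⟨ u , v ⟩ ≈ ⟨ u′ , v′ ⟩
  ⟨⟩-cong u≋ v≋ = ∑-cong λ i → *-cong (u≋ i) (v≋ i)

  ⟨⟩-comm : ∀ u v → ⟨ u , v ⟩ ≈ ⟨ v , u ⟩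
  ⟨⟩-comm u v = ∑-cong λ i → *-comm (u i) (v i)

  ⟨•,⟩ : ∀ x u v → ⟨ x • u , v ⟩ ≈ x * ⟨ u , v ⟩
  ⟨•,⟩ x u v = trans (∑-cong λ i → *-assoc x (u i) (v i)) (sym (∑-*ˡ x _))

  ⟨,•⟩ : ∀ x u v → ⟨ u , x • v ⟩ ≈ x * ⟨ u , v ⟩
  ⟨,•⟩ x u v = trans (⟨⟩-comm u (x • v)) (trans (⟨•,⟩ x v u) (*-congˡ (⟨⟩-comm v u)))

  D-cong : ∀ {u v} → u ≋ v → D u ≋ D v
  D-cong u≋v j = ∑-cong λ k → if-cong (does (j Fin.≤? k)) (*-congˡ (u≋v k))

  ⟦⟧-cong : ∀ w {u v} → u ≋ v → ⟦ w ⟧ u ≋ ⟦ w ⟧ v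
  ⟦⟧-cong []      u≋v   = u≋v
  ⟦⟧-cong (𝕒 ∷ w) u≋v i = *-congˡ (⟦⟧-cong w u≋v i)
  ⟦⟧-cong (𝕕 ∷ w) u≋v   = D-cong (⟦⟧-cong w u≋v)

  A-• : ∀ x v → A (x • v) ≋ x • A v
  A-• x v i = solve 3 (λ a x v → a :* (x :* v) := x :* (a :* v)) refl _ _ _

  D-• : ∀ x v → D (x • v) ≋ x • D v
  D-• x v j = begin
    ∑ (λ k → if does (j Fin.≤? k) then β k * (x * v k) else 0#)
      ≈⟨ ∑-cong (λ k → trans
           (if-cong (does (j Fin.≤? k)) (solve 3 (λ b x v → b :* (x :* v) := x :* (b :* v)) refl _ _ _))
           (sym (if-*ˡ (does (j Fin.≤? k)) x _))) ⟩
    ∑ (λ k → x * (if does (j Fin.≤? k) then β k * v k else 0#))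
      ≈⟨ ∑-*ˡ x (λ k → if does (j Fin.≤? k) then β k * v k else 0#) ⟨
    x * D v j ∎

  ⟦⟧-• : ∀ w x v → ⟦ w ⟧ (x • v) ≋ x • ⟦ w ⟧ v
  ⟦⟧-• []      x v i = refl
  ⟦⟧-• (𝕒 ∷ w) x v i = trans (*-congˡ (⟦⟧-• w x v i)) (A-• x (⟦ w ⟧ v) i)
  ⟦⟧-• (𝕕 ∷ w) x v i = trans (D-cong (⟦⟧-• w x v) i) (D-• x (⟦ w ⟧ v) i)

  ⟦⟧-++ : ∀ w w′ v → ⟦ w ++ w′ ⟧ v ≡ ⟦ w ⟧ (⟦ w′ ⟧ v)
  ⟦⟧-++ []      w′ v = ≡.refl
  ⟦⟧-++ (𝕒 ∷ w) w′ v = ≡.cong A (⟦⟧-++ w w′ v)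
  ⟦⟧-++ (𝕕 ∷ w) w′ v = ≡.cong D (⟦⟧-++ w w′ v)

  ⟨A,⟩ : ∀ u v → ⟨ A u , v ⟩ ≈ ⟨ u , A v ⟩
  ⟨A,⟩ u v = ∑-cong λ i → solve 3 (λ a u v → a :* u :* v := u :* (a :* v)) refl (α i) (u i) (v i)

  -- Both sides are one double sum over `j ≤ k`, taken in the two possible orders.
  ⟨D,⟩ : ∀ u v → ⟨ D u , v ⟩ ≈ ⟨ u , B v ⟩
  ⟨D,⟩ u v = begin
    ∑ (λ j → D u j * v j)
      ≈⟨ ∑-cong (λ j → ∑-*ʳ (v j) _) ⟩
    ∑ (λ j → ∑ λ k → (if does (j Fin.≤? k) then β k * u k else 0#) * v j)
      ≈⟨ ∑-comm (λ j k → (if does (j Fin.≤? k) then β k * u k else 0#) * v j) ⟩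
    ∑ (λ k → ∑ λ j → (if does (j Fin.≤? k) then β k * u k else 0#) * v j)
      ≈⟨ ∑-cong (λ k → ∑-cong λ j → pull (does (j Fin.≤? k)) (β k) (u k) (v j)) ⟩
    ∑ (λ k → ∑ λ j → u k * β k * (if does (j Fin.≤? k) then v j else 0#))
      ≈⟨ ∑-cong (λ k → trans (sym (∑-*ˡ (u k * β k) _)) (*-assoc _ _ _)) ⟩
    ⟨ u , B v ⟩ ∎
    where
    pull : ∀ b x y z → (if b then x * y else 0#) * z ≈ y * x * (if b then z else 0#)
    pull true  x y z = *-congʳ (*-comm x y)
    pull false x y z = trans (zeroˡ z) (sym (zeroʳ _))

  -- A letter that crosses the pairing lands innermost on the other side, hence the reversal in
  -- `dual`; the exchange of letters is already built into `⟦_⟧ᵗ`.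
  ⟨⟩-⟦⟧ᵗ : ∀ w u v → ⟨ u , ⟦ w ⟧ᵗ v ⟩ ≈ ⟨ ⟦ dual w ⟧ u , v ⟩
  ⟨⟩-⟦⟧ᵗ []      u v = refl
  ⟨⟩-⟦⟧ᵗ (𝕒 ∷ w) u v = begin
    ⟨ u , B (⟦ w ⟧ᵗ v) ⟩               ≈⟨ ⟨D,⟩ u (⟦ w ⟧ᵗ v) ⟨
    ⟨ D u , ⟦ w ⟧ᵗ v ⟩                 ≈⟨ ⟨⟩-⟦⟧ᵗ w (D u) v ⟩
    ⟨ ⟦ dual w ⟧ (D u) , v ⟩           ≡⟨ ≡.cong (λ x → ⟨ x , v ⟩) (⟦⟧-++ (dual w) [ 𝕕 ] u) ⟨
    ⟨ ⟦ dual w ++ [ 𝕕 ] ⟧ u , v ⟩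
      ≡⟨ ≡.cong (λ x → ⟨ ⟦ x ⟧ u , v ⟩) (List.unfold-reverse 𝕕 (List.map swap w)) ⟨
    ⟨ ⟦ dual (𝕒 ∷ w) ⟧ u , v ⟩         ∎
  ⟨⟩-⟦⟧ᵗ (𝕕 ∷ w) u v = begin
    ⟨ u , A (⟦ w ⟧ᵗ v) ⟩               ≈⟨ ⟨A,⟩ u (⟦ w ⟧ᵗ v) ⟨
    ⟨ A u , ⟦ w ⟧ᵗ v ⟩                 ≈⟨ ⟨⟩-⟦⟧ᵗ w (A u) v ⟩
    ⟨ ⟦ dual w ⟧ (A u) , v ⟩           ≡⟨ ≡.cong (λ x → ⟨ x , v ⟩) (⟦⟧-++ (dual w) [ 𝕒 ] u) ⟨
    ⟨ ⟦ dual w ++ [ 𝕒 ] ⟧ u , v ⟩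
      ≡⟨ ≡.cong (λ x → ⟨ ⟦ x ⟧ u , v ⟩) (List.unfold-reverse 𝕒 (List.map swap w)) ⟨
    ⟨ ⟦ dual (𝕕 ∷ w) ⟧ u , v ⟩         ∎

  -- `σ` stands for -1, which lets the argument run over a semiring. `A-C` and `D-C` are one
  -- relation solved in two directions, since `σ * σ ≈ 1#` is not assumed.
  module _ (σ : Carrier) (C : Fin n → Vector Carrier n)
           (C-sym : ∀ i j → C i j ≈ C j i)
           (A-C : ∀ i → α i • C i ≋ σ • D (C i))
           (D-C : ∀ i → D (C i) ≋ σ • α i • C i)
           (C-β : ∀ i → 1# ≈ σ * ⟨ C i , β ⟩) where

    private
      Ĉ : Vector Carrier n → Vector Carrier n
      Ĉ v i = ⟨ C i , v ⟩

    A-Ĉ : ∀ v → A (Ĉ v) ≋ σ • Ĉ (B v)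
    A-Ĉ v i = begin
      α i * ⟨ C i , v ⟩      ≈⟨ ⟨•,⟩ (α i) (C i) v ⟨
      ⟨ α i • C i , v ⟩      ≈⟨ ⟨⟩-cong (A-C i) (λ _ → refl) ⟩
      ⟨ σ • D (C i) , v ⟩    ≈⟨ ⟨•,⟩ σ (D (C i)) v ⟩
      σ * ⟨ D (C i) , v ⟩    ≈⟨ *-congˡ (⟨D,⟩ (C i) v) ⟩
      σ * ⟨ C i , B v ⟩      ∎

    -- `D` acts on the free index of `C`. Interchanging the sums and using symmetry puts it on the
    -- rows, where `D-C` applies; the factor `α i` then sits at the summed index and is absorbed
    -- into `v`.
    D-Ĉ : ∀ v → D (Ĉ v) ≋ σ • Ĉ (A v)
    D-Ĉ v j = begin
      ∑ (λ k → if does (j Fin.≤? k) then β k * ⟨ C k , v ⟩ else 0#)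
        ≈⟨ ∑-cong (λ k → expand (does (j Fin.≤? k)) k) ⟩
      ∑ (λ k → ∑ λ i → (if does (j Fin.≤? k) then β k * C i k else 0#) * v i)
        ≈⟨ ∑-comm (λ k i → (if does (j Fin.≤? k) then β k * C i k else 0#) * v i) ⟩
      ∑ (λ i → ∑ λ k → (if does (j Fin.≤? k) then β k * C i k else 0#) * v i)
        ≈⟨ ∑-cong (λ i → sym (∑-*ʳ (v i) _)) ⟩
      ∑ (λ i → D (C i) j * v i)
        ≈⟨ ∑-cong (λ i → trans (*-congʳ (trans (D-C i j) (*-congˡ (*-congˡ (C-sym i j)))))
             (solve 4 (λ s a c v → s :* (a :* c) :* v := s :* (c :* (a :* v))) refl σ (α i) (C j i) (v i))) ⟩
      ∑ (λ i → σ * (C j i * (α i * v i)))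
        ≈⟨ ∑-*ˡ σ (λ i → C j i * (α i * v i)) ⟨
      σ * ⟨ C j , A v ⟩ ∎
      where
      expand : ∀ b k → (if b then β k * ⟨ C k , v ⟩ else 0#) ≈ ∑ λ i → (if b then β k * C i k else 0#) * v i
      expand true  k = trans (∑-*ˡ (β k) (λ i → C k i * v i)) (∑-cong λ i →
        trans (sym (*-assoc _ _ _)) (*-congʳ (*-congˡ (C-sym k i))))
      expand false k = sym (trans (sym (∑-*ˡ 0# v)) (zeroˡ _))

    -- Letters are crossed one at a time, each at the cost of one `σ`, and their order is kept; the
    -- reversal happens only on transposing.
    ⟦⟧-Ĉ : ∀ w v → ⟦ w ⟧ (Ĉ v) ≋ (σ ^ length w) • Ĉ (⟦ w ⟧ᵗ v)
    ⟦⟧-Ĉ []      v i = sym (*-identityˡ _)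
    ⟦⟧-Ĉ (𝕒 ∷ w) v i = begin
      A (⟦ w ⟧ (Ĉ v)) i                           ≈⟨ *-congˡ (⟦⟧-Ĉ w v i) ⟩
      A ((σ ^ length w) • Ĉ (⟦ w ⟧ᵗ v)) i         ≈⟨ A-• (σ ^ length w) (Ĉ (⟦ w ⟧ᵗ v)) i ⟩
      σ ^ length w * A (Ĉ (⟦ w ⟧ᵗ v)) i           ≈⟨ *-congˡ (A-Ĉ (⟦ w ⟧ᵗ v) i) ⟩
      σ ^ length w * (σ * Ĉ (B (⟦ w ⟧ᵗ v)) i)
        ≈⟨ solve 3 (λ p s c → p :* (s :* c) := s :* p :* c) refl _ _ _ ⟩
      σ * σ ^ length w * Ĉ (B (⟦ w ⟧ᵗ v)) i       ∎
    ⟦⟧-Ĉ (𝕕 ∷ w) v i = begin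
      D (⟦ w ⟧ (Ĉ v)) i                           ≈⟨ D-cong (⟦⟧-Ĉ w v) i ⟩
      D ((σ ^ length w) • Ĉ (⟦ w ⟧ᵗ v)) i         ≈⟨ D-• _ _ i ⟩
      σ ^ length w * D (Ĉ (⟦ w ⟧ᵗ v)) i           ≈⟨ *-congˡ (D-Ĉ (⟦ w ⟧ᵗ v) i) ⟩
      σ ^ length w * (σ * Ĉ (A (⟦ w ⟧ᵗ v)) i)
        ≈⟨ solve 3 (λ p s c → p :* (s :* c) := s :* p :* c) refl _ _ _ ⟩
      σ * σ ^ length w * Ĉ (A (⟦ w ⟧ᵗ v)) i       ∎

    ⟨,Ĉ⟩ : ∀ u v → ⟨ u , Ĉ v ⟩ ≈ ⟨ Ĉ u , v ⟩
    ⟨,Ĉ⟩ u v = begin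
      ∑ (λ i → u i * ⟨ C i , v ⟩)               ≈⟨ ∑-cong (λ i → ∑-*ˡ (u i) _) ⟩
      ∑ (λ i → ∑ λ j → u i * (C i j * v j))   ≈⟨ ∑-comm (λ i j → u i * (C i j * v j)) ⟩
      ∑ (λ j → ∑ λ i → u i * (C i j * v j))
        ≈⟨ ∑-cong (λ j → ∑-cong λ i → trans (*-congˡ (*-congʳ (C-sym i j)))
             (solve 3 (λ u c v → u :* (c :* v) := c :* u :* v) refl (u i) (C j i) (v j))) ⟩
      ∑ (λ j → ∑ λ i → C j i * u i * v j)     ≈⟨ ∑-cong (λ j → sym (∑-*ʳ (v j) _)) ⟩
      ⟨ Ĉ u , v ⟩                                 ∎

    -- `Ĉ` enters at the right end through `𝟏 ≋ σ • Ĉ β`, crosses the word, changes sides by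
    -- symmetry, and is absorbed by the left-hand `β`, which becomes `𝟏`. The absorption uses up the
    -- `σ` introduced at the start, so exactly one factor per letter survives.
    duality : ∀ w → ⟨ β , ⟦ w ⟧ 𝟏 ⟩ ≈ σ ^ length w * ⟨ β , ⟦ dual w ⟧ 𝟏 ⟩
    duality w = begin
      ⟨ β , ⟦ w ⟧ 𝟏 ⟩
        ≈⟨ ⟨⟩-cong {β} (λ _ → refl) (λ i → trans (⟦⟧-cong w C-β i) (trans (⟦⟧-• w σ (Ĉ β) i) (*-congˡ (⟦⟧-Ĉ w β i)))) ⟩
      ⟨ β , σ • (σ ^ length w) • Ĉ (⟦ w ⟧ᵗ β) ⟩
        ≈⟨ trans (⟨,•⟩ _ β _) (*-congˡ (⟨,•⟩ _ β _)) ⟩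
      σ * (σ ^ length w * ⟨ β , Ĉ (⟦ w ⟧ᵗ β) ⟩)
        ≈⟨ *-congˡ (*-congˡ (⟨,Ĉ⟩ β (⟦ w ⟧ᵗ β))) ⟩
      σ * (σ ^ length w * ⟨ Ĉ β , ⟦ w ⟧ᵗ β ⟩)
        ≈⟨ solve 3 (λ s p x → s :* (p :* x) := p :* (s :* x)) refl _ _ _ ⟩
      σ ^ length w * (σ * ⟨ Ĉ β , ⟦ w ⟧ᵗ β ⟩)
        ≈⟨ *-congˡ (⟨•,⟩ σ (Ĉ β) _) ⟨
      σ ^ length w * ⟨ σ • Ĉ β , ⟦ w ⟧ᵗ β ⟩
        ≈⟨ *-congˡ (⟨⟩-cong (λ i → sym (C-β i)) (λ _ → refl)) ⟩
      σ ^ length w * ⟨ 𝟏 , ⟦ w ⟧ᵗ β ⟩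
        ≈⟨ *-congˡ (trans (⟨⟩-⟦⟧ᵗ w 𝟏 β) (⟨⟩-comm _ β)) ⟩
      σ ^ length w * ⟨ β , ⟦ dual w ⟧ 𝟏 ⟩ ∎

  -- `t≈` abstracts the factorisation q^(sk)/[k]^(s+1) = (1/[k]) (q^k/[k])^s: one weight of `D` and
  -- `s` weights of `A`.
  module _ (t : ℕ → Vector Carrier n) (t≈ : ∀ s k → t (suc s) k ≈ β k * α k ^ s) where
    open ChainSum t

    ⟦𝕒ˢ⟧ : ∀ s w v k → ⟦ List.replicate s 𝕒 ++ w ⟧ v k ≈ α k ^ s * ⟦ w ⟧ v k
    ⟦𝕒ˢ⟧ zero    w v k = sym (*-identityˡ _)
    ⟦𝕒ˢ⟧ (suc s) w v k = trans (*-congˡ (⟦𝕒ˢ⟧ s w v k)) (sym (*-assoc _ _ _))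

    t-* : ∀ s w v k → t (suc s) k * ⟦ w ⟧ v k ≈ β k * ⟦ List.replicate s 𝕒 ++ w ⟧ v k
    t-* s w v k = trans (*-congʳ (t≈ s k)) (trans (*-assoc _ _ _) (*-congˡ (sym (⟦𝕒ˢ⟧ s w v k))))

    tailSum-word : ∀ {s} → All NonZero s → tailSum s ≋ ⟦ word s ⟧ 𝟏
    tailSum-word {[]}        []        j = +-identityʳ _
    tailSum-word {suc x ∷ s} (_ ∷ s≢0) j = begin
      tailSum (suc x ∷ s) j
        ≈⟨ tailSum-∷ (suc x) s j ⟩
      ∑ (λ k → if does (j Fin.≤? k) then t (suc x) k * tailSum s k else 0#)
        ≈⟨ ∑-cong (λ k → if-cong (does (j Fin.≤? k))
             (trans (*-congˡ (tailSum-word s≢0 k)) (t-* x (word s) 𝟏 k))) ⟩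
      ⟦ word (suc x ∷ s) ⟧ 𝟏 j ∎

    -- The first index has no lower bound, so the leading 𝕕 is replaced by the pairing with `β`.
    chainSum-word : ∀ {s w} → All NonZero s → word s ≡ 𝕕 ∷ w → chainSum s ≈ ⟨ β , ⟦ w ⟧ 𝟏 ⟩
    chainSum-word {suc x ∷ s} (_ ∷ s≢0) ≡.refl = trans (chainSum-∷ (suc x) s)
      (∑-cong λ k → trans (*-congˡ (tailSum-word s≢0 k)) (t-* x (word s) 𝟏 k))

-- q-integers in a commutative ring, and the connector matrix.

module QIntegers {c ℓ} (R : CommutativeRing c ℓ) where
  open CommutativeRing R
  open RingProperties ring using (-1*x≈-x)
  open GroupProperties +-group using (inverseˡ-unique)
  open Exp commutativeSemiring using (_^_; ^-homo-*; ^-distrib-*; ^-congˡ; ^-congʳ)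
  open SemiringSum semiring using (sum-cong-≋) renaming (sum to ∑)
  open SemiringSolver commutativeSemiring using (solve; con; _:+_; _:*_; _:=_)
  open SetoidReasoning setoid

  -- The q-integer [m], with `x` in place of q.
  geo : Carrier → ℕ → Carrier
  geo x zero    = 0#
  geo x (suc m) = 1# + x * geo x m

  geo-unique : ∀ x (f : ℕ → Carrier) → f 0 ≈ 0# → (∀ m → f (suc m) ≈ 1# + x * f m) → ∀ m → f m ≈ geo x m
  geo-unique x f f0 fsuc zero    = f0
  geo-unique x f f0 fsuc (suc m) = trans (fsuc m) (+-congˡ (*-congˡ (geo-unique x f f0 fsuc m)))

  geo-+ : ∀ x l m → geo x (l ℕ.+ m) ≈ geo x l + x ^ l * geo x m
  geo-+ x zero    m = sym (trans (+-identityˡ _) (*-identityˡ _))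
  geo-+ x (suc l) m = trans (+-congˡ (*-congˡ (geo-+ x l m)))
    (solve 4 (λ x g p h → con 1 :+ x :* (g :+ p :* h) := (con 1 :+ x :* g) :+ x :* p :* h) refl x _ _ _)

  -- The powers of `x` are grouped into `l` runs of length `m`. Hence [m] = 0 forces [lm] = 0, and
  -- the cofactor is explicit enough to serve as an inverse in `geo-unit`.
  geo-* : ∀ x l m → geo x (l ℕ.* m) ≈ geo x m * geo (x ^ m) l
  geo-* x zero    m = sym (zeroʳ _)
  geo-* x (suc l) m = begin
    geo x (m ℕ.+ l ℕ.* m)                       ≈⟨ geo-+ x m (l ℕ.* m) ⟩
    geo x m + x ^ m * geo x (l ℕ.* m)           ≈⟨ +-congˡ (*-congˡ (geo-* x l m)) ⟩
    geo x m + x ^ m * (geo x m * geo (x ^ m) l)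
      ≈⟨ solve 3 (λ g p h → g :+ p :* (g :* h) := g :* (con 1 :+ p :* h)) refl _ _ _ ⟩
    geo x m * (1# + x ^ m * geo (x ^ m) l)      ∎

  -1*-1≈1 : - 1# * - 1# ≈ 1#
  -1*-1≈1 = trans (-1*x≈-x (- 1#)) (GroupProperties.⁻¹-involutive +-group 1#)

  x+y≈0⇒x≈-1*y : ∀ {x y} → x + y ≈ 0# → x ≈ - 1# * y
  x+y≈0⇒x≈-1*y x+y≈0 = trans (inverseˡ-unique _ _ x+y≈0) (sym (-1*x≈-x _))

  -- From a Bézout relation i l = 1 + j m, `geo-*` gives `geo x l * geo (x ^ l) i` = [il] = 1 + x
  -- [jm] = 1. For the opposite sign, 1 + i l = j m gives 1 + x [il] = [jm] = 0, which accounts for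
  -- the factor -x in the inverse.
  geo-unit : ∀ x {l m} → geo x m ≈ 0# → Coprime l m → ∃ λ u → geo x l * u ≈ 1#
  geo-unit x {l} {m} [m]≈0 coprime with coprime-Bézout coprime
  ... | Bézout.+- i j eq = geo (x ^ l) i , (begin
    geo x l * geo (x ^ l) i   ≈⟨ geo-* x i l ⟨
    geo x (i ℕ.* l)           ≡⟨ ≡.cong (geo x) eq ⟨
    1# + x * geo x (j ℕ.* m)  ≈⟨ +-congˡ (*-congˡ (trans (geo-* x j m) (trans (*-congʳ [m]≈0) (zeroˡ _)))) ⟩
    1# + x * 0#               ≈⟨ trans (+-congˡ (zeroʳ x)) (+-identityʳ 1#) ⟩
    1#                        ∎)
  ... | Bézout.-+ i j eq = - 1# * (x * geo (x ^ l) i) , (begin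
    geo x l * (- 1# * (x * geo (x ^ l) i))
      ≈⟨ solve 4 (λ g s x h → g :* (s :* (x :* h)) := s :* (x :* (g :* h))) refl _ _ x _ ⟩
    - 1# * (x * (geo x l * geo (x ^ l) i))   ≈⟨ *-congˡ (*-congˡ (geo-* x i l)) ⟨
    - 1# * (x * geo x (i ℕ.* l))             ≈⟨ x+y≈0⇒x≈-1*y 1+x[il]≈0 ⟨
    1#                                       ∎)
    where
    1+x[il]≈0 : 1# + x * geo x (i ℕ.* l) ≈ 0#
    1+x[il]≈0 = trans (reflexive (≡.cong (geo x) eq)) (trans (geo-* x j m) (trans (*-congʳ [m]≈0) (zeroˡ _)))

  -- `geo x (suc m)` unfolds to 1 + x [m], so its vanishing exhibits -[m] as the inverse of `x`.
  geo-unitʳ : ∀ x {m} → geo x (suc m) ≈ 0# → x * (- 1# * geo x m) ≈ 1#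
  geo-unitʳ x {m} eq = begin
    x * (- 1# * geo x m)  ≈⟨ solve 3 (λ x s g → x :* (s :* g) := s :* (x :* g)) refl x _ _ ⟩
    - 1# * (x * geo x m)  ≈⟨ x+y≈0⇒x≈-1*y eq ⟨
    1#                    ∎

  -- The hypothesis is X k = Y (k+1) - Y k with the subtraction cleared, and likewise the
  -- conclusion.
  telescope : ∀ (X Y : ℕ → Carrier) n → (∀ k → k ℕ.< n → X k + Y k ≈ Y (suc k)) →
              ∑ {n} (λ k → X (toℕ k)) + Y 0 ≈ Y n
  telescope X Y zero    step = +-identityˡ _
  telescope X Y (suc n) step = begin
    X 0 + ∑ {n} (λ k → X (suc (toℕ k))) + Y 0
      ≈⟨ solve 3 (λ x s y → x :+ s :+ y := s :+ (x :+ y)) refl _ _ _ ⟩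
    ∑ {n} (λ k → X (suc (toℕ k))) + (X 0 + Y 0)   ≈⟨ +-congˡ (step 0 (s≤s z≤n)) ⟩
    ∑ {n} (λ k → X (suc (toℕ k))) + Y 1
      ≈⟨ telescope (X ∘ suc) (Y ∘ suc) n (λ k k<n → step (suc k) (s≤s k<n)) ⟩
    Y (suc n) ∎

  telescope-from : ∀ (X Y : ℕ → Carrier) {n} (j : Fin n) → (∀ k → k ℕ.< n → X k + Y k ≈ Y (suc k)) →
                   ∑ {n} (λ k → if does (j Fin.≤? k) then X (toℕ k) else 0#) + Y (toℕ j) ≈ Y n
  telescope-from X Y {suc n} zero    step = telescope X Y (suc n) step
  telescope-from X Y {suc n} (suc j) step = begin
    0# + ∑ {n} (λ k → if does (suc j Fin.≤? suc k) then X (suc (toℕ k)) else 0#) + Y (suc (toℕ j))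
      ≈⟨ +-congʳ (trans (+-identityˡ _) (sum-cong-≋ {n} λ k →
           reflexive (≡.cong (λ b → if b then X (suc (toℕ k)) else 0#) (does-suc k)))) ⟩
    ∑ {n} (λ k → if does (j Fin.≤? k) then X (suc (toℕ k)) else 0#) + Y (suc (toℕ j))
      ≈⟨ telescope-from (X ∘ suc) (Y ∘ suc) j (λ k k<n → step (suc k) (s≤s k<n)) ⟩
    Y (suc n) ∎
    where
    -- The two Boolean tests are stuck until it is known whether `toℕ j` is zero.
    does-suc : ∀ k → does (suc j Fin.≤? suc k) ≡ does (j Fin.≤? k)
    does-suc k with toℕ j
    ... | zero  = ≡.refl
    ... | suc _ = ≡.refl

  module _ (q Q : Carrier) (qQ≈1 : q * Q ≈ 1#) (n : ℕ) (β : ℕ → Carrier)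
           ([n+1]≈0 : geo q (suc n) ≈ 0#)
           (geo-β : ∀ k → k ℕ.< n → geo q (suc k) * β k ≈ 1#) where

    α : ℕ → Carrier
    α k = q ^ suc k * β k

    -- `F m` is the q-factorial [m]!, and `G m` is its inverse as long as `m ≤ n`.
    F G : ℕ → Carrier
    F zero    = 1#
    F (suc m) = F m * geo q (suc m)
    G zero    = 1#
    G (suc m) = G m * β m

    -- With i and j shifted to start from 1, this is q⁻ⁱʲ [i+j-1]! / ([i-1]! [j-1]!).
    connector : ℕ → ℕ → Carrier
    connector i j = Q ^ (suc i ℕ.* suc j) * F (suc i ℕ.+ j) * (G i * G j)

    connector-sym : ∀ i j → connector i j ≈ connector j i
    connector-sym i j = *-cong
      (*-cong (^-congʳ Q (ℕ.*-comm (suc i) (suc j))) (reflexive (≡.cong (F ∘ suc) (ℕ.+-comm i j))))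
      (*-comm (G i) (G j))

    q^Q^≈1 : ∀ m → q ^ m * Q ^ m ≈ 1#
    q^Q^≈1 m = trans (sym (^-distrib-* q Q m)) (trans (^-congˡ m qQ≈1) (1^ m))
      where
      1^ : ∀ m → 1# ^ m ≈ 1#
      1^ zero    = refl
      1^ (suc m) = trans (*-identityˡ _) (1^ m)

    FG≈1 : ∀ m → m ℕ.≤ n → F m * G m ≈ 1#
    FG≈1 zero    _   = *-identityˡ 1#
    FG≈1 (suc m) m<n = begin
      F m * geo q (suc m) * (G m * β m)
        ≈⟨ solve 4 (λ f h g b → f :* h :* (g :* b) := (f :* g) :* (h :* b)) refl (F m) (geo q (suc m)) (G m) (β m) ⟩
      (F m * G m) * (geo q (suc m) * β m)   ≈⟨ *-cong (FG≈1 m (ℕ.<⇒≤ m<n)) (geo-β m m<n) ⟩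
      1# * 1#                               ≈⟨ *-identityˡ 1# ⟩
      1#                                    ∎

    -- From [n+1]! on, every factorial contains the factor [n+1] = 0.
    F≈0 : ∀ i → F (suc i ℕ.+ n) ≈ 0#
    F≈0 zero    = trans (*-congˡ [n+1]≈0) (zeroʳ _)
    F≈0 (suc i) = trans (*-congʳ (F≈0 i)) (zeroˡ _)

    -- Column `n` is j = p in the unshifted numbering, one past the last index. It gives the upper
    -- boundary term of the telescoping sums.
    connector-n : ∀ i → connector i n ≈ 0#
    connector-n i = trans (*-congʳ (trans (*-congˡ (F≈0 i)) (zeroʳ _))) (zeroˡ _)

    -- Column 0 is j = 1, where in the unshifted numbering the connector collapses to q^(-i) [i]! /
    -- [i-1]! = 1/α_i. This gives the lower boundary term when all columns are summed.
    α-connector-0 : ∀ i → i ℕ.< n → α i * connector i 0 ≈ 1#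
    α-connector-0 i i<n = begin
      q ^ suc i * β i * (Q ^ (suc i ℕ.* 1) * F (suc i ℕ.+ 0) * (G i * 1#))
        ≈⟨ *-congˡ (*-congʳ (*-cong (^-congʳ Q (ℕ.*-identityʳ (suc i)))
             (reflexive (≡.cong F (ℕ.+-identityʳ (suc i)))))) ⟩
      q ^ suc i * β i * (Q ^ suc i * F (suc i) * (G i * 1#))
        ≈⟨ solve 5 (λ q b Q f g → q :* b :* (Q :* f :* (g :* con 1)) := (q :* Q) :* (f :* (g :* b))) refl
             (q ^ suc i) (β i) (Q ^ suc i) (F (suc i)) (G i) ⟩
      q ^ suc i * Q ^ suc i * (F (suc i) * G (suc i))
        ≈⟨ *-cong (q^Q^≈1 (suc i)) (FG≈1 (suc i) i<n) ⟩
      1# * 1#   ≈⟨ *-identityˡ 1# ⟩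
      1#        ∎

    -- In the unshifted numbering β_k + α_i = ([i] + q^i [k]) / ([i][k]) = [i+k] / ([i][k]). This
    -- factor raises k by one in the factorials and leaves 1/[i]; together with the q^i needed to
    -- correct the power of q, that is α_i.
    connector-step : ∀ i k → i ℕ.< n → k ℕ.< n →
      β k * connector i k + α i * connector i k ≈ α i * connector i (suc k)
    connector-step i k i<n k<n = begin
      β k * C + α i * C
        ≈⟨ distribʳ C (β k) (α i) ⟨
      (β k + α i) * C
        -- Both summands are brought over a common denominator, using [i] β_i = 1 and [k] β_k = 1.
        ≈⟨ *-congʳ (+-cong (unit (geo-β i i<n)) (unit (geo-β k k<n))) ⟩
      (gᵢ * β i * β k + gₖ * β k * (qⁱ * β i)) * (Qⁱᵏ * f * (G i * G k))
        ≈⟨ solve 9 (λ g b b′ g′ q Q f G G′ →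
             (g :* b :* b′ :+ g′ :* b′ :* (q :* b)) :* (Q :* f :* (G :* G′))
             := b :* (Q :* (f :* (g :+ q :* g′)) :* (G :* (G′ :* b′)))) refl
             gᵢ (β i) (β k) gₖ qⁱ Qⁱᵏ f (G i) (G k) ⟩
      β i * (Qⁱᵏ * (f * (gᵢ + qⁱ * gₖ)) * (G i * G (suc k)))
        ≈⟨ *-congˡ (*-congʳ (*-congˡ (trans (*-congˡ (sym (geo-+ q (suc i) (suc k)))) F-suc))) ⟩
      β i * (Qⁱᵏ * F (suc i ℕ.+ suc k) * (G i * G (suc k)))
        -- Inserting q^i Q^i = 1 supplies the q^i in α_i and moves the exponent of `Q` from i k to i
        -- (k+1).
        ≈⟨ trans (sym (*-identityˡ _)) (*-congʳ (sym (q^Q^≈1 (suc i)))) ⟩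
      qⁱ * Q ^ suc i * (β i * (Qⁱᵏ * F (suc i ℕ.+ suc k) * (G i * G (suc k))))
        ≈⟨ solve 6 (λ q Q b r f g → q :* Q :* (b :* (r :* f :* g)) := q :* b :* ((Q :* r) :* f :* g)) refl
             qⁱ (Q ^ suc i) (β i) Qⁱᵏ (F (suc i ℕ.+ suc k)) (G i * G (suc k)) ⟩
      α i * (Q ^ suc i * Qⁱᵏ * F (suc i ℕ.+ suc k) * (G i * G (suc k)))
        ≈⟨ *-congˡ (*-congʳ (*-congʳ (trans (sym (^-homo-* Q (suc i) (suc i ℕ.* suc k)))
             (^-congʳ Q (≡.sym (ℕ.*-suc (suc i) (suc k))))))) ⟩
      α i * connector i (suc k) ∎
      where
      C = connector i k
      gᵢ = geo q (suc i)
      gₖ = geo q (suc k)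
      qⁱ = q ^ suc i
      Qⁱᵏ = Q ^ (suc i ℕ.* suc k)
      f = F (suc i ℕ.+ k)
      unit : ∀ {x y} → x ≈ 1# → y ≈ x * y
      unit x≈1 = sym (trans (*-congʳ x≈1) (*-identityˡ _))
      F-suc : F (suc i ℕ.+ k) * geo q (suc i ℕ.+ suc k) ≈ F (suc i ℕ.+ suc k)
      F-suc rewrite ℕ.+-suc i k = refl

    open Operators commutativeSemiring {n} (α ∘ toℕ) (β ∘ toℕ)

    private
      C : Fin n → Fin n → Carrier
      C i j = connector (toℕ i) (toℕ j)

      D-C+α-C : ∀ i j → D (C i) j + α (toℕ i) * C i j ≈ 0#
      D-C+α-C i j = trans
        (telescope-from (λ k → β k * connector (toℕ i) k) (λ k → α (toℕ i) * connector (toℕ i) k) j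
          (λ k k<n → connector-step (toℕ i) k (Fin.toℕ<n i) k<n))
        (trans (*-congˡ (connector-n (toℕ i))) (zeroʳ _))

      -- The telescoping of `D-C+α-C`, started at column 0, where `α-connector-0` turns the boundary
      -- term into `1#`.
      C-β+1 : ∀ i → ⟨ C i , β ∘ toℕ ⟩ + 1# ≈ 0#
      C-β+1 i = begin
        ⟨ C i , β ∘ toℕ ⟩ + 1#
          ≈⟨ +-cong (⟨⟩-comm (C i) (β ∘ toℕ)) (sym (α-connector-0 (toℕ i) (Fin.toℕ<n i))) ⟩
        ⟨ β ∘ toℕ , C i ⟩ + α (toℕ i) * connector (toℕ i) 0
          ≈⟨ telescope (λ k → β k * connector (toℕ i) k) (λ k → α (toℕ i) * connector (toℕ i) k) n
               (λ k k<n → connector-step (toℕ i) k (Fin.toℕ<n i) k<n) ⟩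
        α (toℕ i) * connector (toℕ i) n
          ≈⟨ trans (*-congˡ (connector-n (toℕ i))) (zeroʳ _) ⟩
        0# ∎

    q-duality : ∀ w → ⟨ β ∘ toℕ , ⟦ w ⟧ 𝟏 ⟩ ≈ (- 1#) ^ length w * ⟨ β ∘ toℕ , ⟦ dual w ⟧ 𝟏 ⟩
    q-duality = duality (- 1#) C (λ i j → connector-sym (toℕ i) (toℕ j))
      (λ i j → x+y≈0⇒x≈-1*y (trans (+-comm _ _) (D-C+α-C i j)))
      (λ i j → x+y≈0⇒x≈-1*y (D-C+α-C i j))
      (λ i → x+y≈0⇒x≈-1*y (trans (+-comm _ _) (C-β+1 i)))

-- Passage from ℤ[q] to ℚ[q].

fromℤ-+ : ∀ i j → ℚ.fromℤ (i ℤ.+ j) ≡ ℚ.fromℤ i ℚ.+ ℚ.fromℤ j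
-- The operations of ℚ normalise, so the identity is checked on unnormalised fractions, where all
-- denominators are 1.
fromℤ-+ i j = ℚ.toℚᵘ-injective (ℚᵘ.≃-trans
  (ℚᵘ.*≡* (≡.cong (ℤ._* 1ℤ) (≡.sym (≡.cong₂ ℤ._+_ (ℤ.*-identityʳ i) (ℤ.*-identityʳ j)))))
  (ℚᵘ.≃-sym (ℚ.toℚᵘ-homo-+ (ℚ.fromℤ i) (ℚ.fromℤ j))))

fromℤ-* : ∀ i j → ℚ.fromℤ (i ℤ.* j) ≡ ℚ.fromℤ i ℚ.* ℚ.fromℤ j
fromℤ-* i j = ℚ.toℚᵘ-injective (ℚᵘ.≃-trans
  (ℚᵘ.*≡* ≡.refl)
  (ℚᵘ.≃-sym (ℚ.toℚᵘ-homo-* (ℚ.fromℤ i) (ℚ.fromℤ j))))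

toℚ[q]-+ : ∀ f g → toℚ[q] (f ℤ[q].+ g) ≡ toℚ[q] f ℚ[q].+ toℚ[q] g
toℚ[q]-+ []      g       = ≡.refl
toℚ[q]-+ (x ∷ f) []      = ≡.refl
toℚ[q]-+ (x ∷ f) (y ∷ g) = ≡.cong₂ _∷_ (fromℤ-+ x y) (toℚ[q]-+ f g)

toℚ[q]-* : ∀ f g → toℚ[q] (f ℤ[q].* g) ≡ toℚ[q] f ℚ[q].* toℚ[q] g
toℚ[q]-* []      g = ≡.refl
toℚ[q]-* (x ∷ f) g = ≡.trans (toℚ[q]-+ (List.map (x ℤ.*_) g) (0ℤ ∷ f ℤ[q].* g))
  (≡.cong₂ ℚ[q]._+_ scale (≡.cong (ℚ.0ℚ ∷_) (toℚ[q]-* f g)))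
  where
  scale : toℚ[q] (List.map (x ℤ.*_) g) ≡ List.map (ℚ.fromℤ x ℚ.*_) (toℚ[q] g)
  scale = ≡.trans (≡.sym (List.map-∘ g)) (≡.trans (List.map-cong (fromℤ-* x) g) (List.map-∘ g))

toℚ[q]-cong : ∀ {f g} → f ℤ[q].≈ g → toℚ[q] f ℚ[q].≈ toℚ[q] g
toℚ[q]-cong {f} {g} f≈g n = ≡.trans (coeff-toℚ f n) (≡.trans (≡.cong ℚ.fromℤ (f≈g n)) (≡.sym (coeff-toℚ g n)))
  where
  coeffℚ = Polynomial.coeff ℚ.+-*-rawRing
  coeff-toℚ : ∀ f n → coeffℚ (toℚ[q] f) n ≡ ℚ.fromℤ (ℤ[q].coeff f n)
  coeff-toℚ []      n       = ≡.refl
  coeff-toℚ (x ∷ f) zero    = ≡.refl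
  coeff-toℚ (x ∷ f) (suc n) = coeff-toℚ f n

-- Fractions with invertible denominators, and coprimality.

module Fractions {c ℓ} (R : CommutativeRing c ℓ) where
  open CommutativeRing R
  open RawMagmaDefs (Semiring.*-rawMagma semiring) using (_,_)
  open RawSemiringDefs (Semiring.rawSemiring semiring) using (_∣_; _^_)
  open RingProperties ring using (-‿distribˡ-*)
  open SemiringSolver commutativeSemiring using (solve; _:+_; _:*_; _:=_)
  open SetoidReasoning setoid

  -- A common divisor of `g` and `h` divides g u - k h, which is 1.
  unit-mod⇒∣1 : ∀ {z g h} u k → g * u ≈ 1# + k * h → z ∣ g → z ∣ h → z ∣ 1#
  unit-mod⇒∣1 {z} {g} {h} u k gu≈1+kh (a , az≈g) (b , bz≈h) = a * u + - (k * b) , (begin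
    (a * u + - (k * b)) * z         ≈⟨ distribʳ z (a * u) (- (k * b)) ⟩
    a * u * z + - (k * b) * z       ≈⟨ +-cong (solve 3 (λ a u z → a :* u :* z := a :* z :* u) refl a u z)
                                              (sym (-‿distribˡ-* (k * b) z)) ⟩
    a * z * u + - (k * b * z)       ≈⟨ +-cong (trans (*-congʳ az≈g) gu≈1+kh) (-‿cong (trans (*-assoc k b z) (*-congˡ bz≈h))) ⟩
    1# + k * h + - (k * h)          ≈⟨ +-assoc 1# (k * h) (- (k * h)) ⟩
    1# + (k * h + - (k * h))        ≈⟨ +-congˡ (-‿inverseʳ (k * h)) ⟩
    1# + 0#                         ≈⟨ +-identityʳ 1# ⟩
    1#                              ∎)

  -- `x` is the value of f/g in a ring where `g` is a unit. The inverse is stored because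
  -- invertibility modulo [p]_q later proves the denominator coprime to [p]_q.
  record IsFraction (x f g : Carrier) : Set (c Level.⊔ ℓ) where
    constructor isFraction
    field
      {g⁻¹}    : Carrier
      g*g⁻¹≈1  : g * g⁻¹ ≈ 1#
      f≈x*g    : f ≈ x * g

  *-unit : ∀ {g g⁻¹ h h⁻¹} → g * g⁻¹ ≈ 1# → h * h⁻¹ ≈ 1# → (g * h) * (g⁻¹ * h⁻¹) ≈ 1#
  *-unit {g} {g⁻¹} {h} {h⁻¹} p r = begin
    (g * h) * (g⁻¹ * h⁻¹)
      ≈⟨ solve 4 (λ g h i j → (g :* h) :* (i :* j) := (g :* i) :* (h :* j)) refl g h g⁻¹ h⁻¹ ⟩
    (g * g⁻¹) * (h * h⁻¹)   ≈⟨ *-cong p r ⟩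
    1# * 1#                 ≈⟨ *-identityˡ 1# ⟩
    1#                      ∎

  +-fraction : ∀ {x f g x′ f′ g′} → IsFraction x f g → IsFraction x′ f′ g′ →
               IsFraction (x + x′) (f * g′ + f′ * g) (g * g′)
  +-fraction {x} {f} {g} {x′} {f′} {g′} (isFraction u e) (isFraction u′ e′) = isFraction (*-unit u u′) (begin
    f * g′ + f′ * g              ≈⟨ +-cong (*-congʳ e) (*-congʳ e′) ⟩
    x * g * g′ + x′ * g′ * g
      ≈⟨ solve 4 (λ x g x′ g′ → x :* g :* g′ :+ x′ :* g′ :* g := (x :+ x′) :* (g :* g′)) refl x g x′ g′ ⟩
    (x + x′) * (g * g′)          ∎)

  *-fraction : ∀ {x f g x′ f′ g′} → IsFraction x f g → IsFraction x′ f′ g′ →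
               IsFraction (x * x′) (f * f′) (g * g′)
  *-fraction {x} {f} {g} {x′} {f′} {g′} (isFraction u e) (isFraction u′ e′) = isFraction (*-unit u u′)
    (trans (*-cong e e′) (solve 4 (λ x g x′ g′ → (x :* g) :* (x′ :* g′) := (x :* x′) :* (g :* g′)) refl x g x′ g′))

  neg-fraction : ∀ {x f g} → IsFraction x f g → IsFraction (- x) (- f) g
  neg-fraction {x} {f} {g} (isFraction u e) = isFraction u (trans (-‿cong e) (-‿distribˡ-* x g))

  0-fraction : IsFraction 0# 0# 1#
  0-fraction = isFraction (*-identityˡ 1#) (sym (zeroˡ 1#))

  1-fraction : IsFraction 1# 1# 1#
  1-fraction = isFraction (*-identityˡ 1#) (sym (*-identityˡ 1#))

  ^-unit : ∀ {g u} s → g * u ≈ 1# → g ^ s * u ^ s ≈ 1#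
  ^-unit zero    _ = *-identityˡ 1#
  ^-unit (suc s) p = *-unit p (^-unit s p)

  unit-fraction : ∀ {f g u} → g * u ≈ 1# → IsFraction (f * u) f g
  unit-fraction {f} {g} {u} p = isFraction p (sym (trans (*-assoc f u g)
    (trans (*-congˡ (trans (*-comm u g) p)) (*-identityʳ f))))

  fraction-≈0 : ∀ {x f g} → IsFraction x f g → x ≈ 0# → f ≈ 0#
  fraction-≈0 (isFraction _ e) x≈0 = trans e (trans (*-congʳ x≈0) (zeroˡ _))

ℤ[q]-ring : CommutativeRing _ _
ℤ[q]-ring = polynomialRing ℤ.+-*-commutativeRing

ℚ[q]-ring : CommutativeRing _ _
ℚ[q]-ring = polynomialRing ℚ.+-*-commutativeRing

-- A Bézout relation over ℤ[q] is a polynomial identity, so it persists in ℚ[q], where coprimality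
-- is measured.
unit-mod⇒coprime : ∀ {g h} u k → g ℤ[q].* u ℤ[q].≈ ℤ[q].1# ℤ[q].+ k ℤ[q].* h →
                   ℚ[q].Coprime (toℚ[q] g) (toℚ[q] h)
unit-mod⇒coprime {g} {h} u k gu≈1+kh {z} = unit-mod⇒∣1 {z} (toℚ[q] u) (toℚ[q] k) eq
  where
  open Fractions ℚ[q]-ring
  open CommutativeRing ℚ[q]-ring using (setoid)
  open SetoidReasoning setoid
  eq : toℚ[q] g ℚ[q].* toℚ[q] u ℚ[q].≈ ℚ[q].1# ℚ[q].+ toℚ[q] k ℚ[q].* toℚ[q] h
  eq = begin
    toℚ[q] g ℚ[q].* toℚ[q] u                           ≡⟨ toℚ[q]-* g u ⟨
    toℚ[q] (g ℤ[q].* u)                                ≈⟨ toℚ[q]-cong {g ℤ[q].* u} {ℤ[q].1# ℤ[q].+ k ℤ[q].* h} gu≈1+kh ⟩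
    toℚ[q] (ℤ[q].1# ℤ[q].+ k ℤ[q].* h)                 ≡⟨ toℚ[q]-+ ℤ[q].1# (k ℤ[q].* h) ⟩
    ℚ[q].1# ℚ[q].+ toℚ[q] (k ℤ[q].* h)                 ≡⟨ ≡.cong (ℚ[q].1# ℚ[q].+_) (toℚ[q]-* k h) ⟩
    ℚ[q].1# ℚ[q].+ toℚ[q] k ℚ[q].* toℚ[q] h            ∎

-- Duality of chain sums in a ring where [p]_q vanishes.

module QSums {c ℓ} (R : CommutativeRing c ℓ) (q : CommutativeRing.Carrier R) (n : ℕ) (prime : Prime (suc n))
             ([p]≈0 : CommutativeRing._≈_ R (QIntegers.geo R q (suc n)) (CommutativeRing.0# R)) where
  open CommutativeRing R hiding (zero) renaming (_+_ to _⊕_; -_ to ⊝_)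
  open RawSemiringDefs (Semiring.rawSemiring semiring) using (_^_)
  open Fractions R
  open QIntegers R
  open Exp commutativeSemiring using (^-assocʳ; ^-distrib-*; ^-congʳ)
  open SemiringSolver commutativeSemiring using (solve; _:*_; _:=_)
  open SetoidReasoning setoid

  geo-inverse : ∀ k → k ℕ.< n → ∃ λ u → geo q (suc k) * u ≈ 1#
  geo-inverse k k<n = geo-unit q [p]≈0 (Coprimality.sym (prime⇒coprime prime (s≤s k<n)))

  -- The index is shifted: β k is 1/[k+1]_q for k < n, and junk for k ≥ n.
  β : ℕ → Carrier
  β k with k ℕ.<? n
  ... | yes k<n = proj₁ (geo-inverse k k<n)
  ... | no _    = 0#

  geo-β : ∀ k → k ℕ.< n → geo q (suc k) * β k ≈ 1#
  geo-β k k<n with k ℕ.<? n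
  ... | yes k<n′ = proj₂ (geo-inverse k k<n′)
  ... | no k≮n   = contradiction k<n k≮n

  t : ℕ → Vector Carrier n
  t s k = q ^ ((s ∸ 1) ℕ.* suc (toℕ k)) * β (toℕ k) ^ s

  -- The inverse of `q`, read off from 1 + q [p-1] = [p] = 0.
  Q : Carrier
  Q = ⊝ 1# * geo q n

  open Operators commutativeSemiring {n} (λ k → q ^ suc (toℕ k) * β (toℕ k)) (β ∘ toℕ)
  open Sums commutativeSemiring {n} using (module ChainSum)
  open ChainSum using (chainSum)

  t-suc : ∀ s k → t (suc s) k ≈ β (toℕ k) * (q ^ suc (toℕ k) * β (toℕ k)) ^ s
  t-suc s k = begin
    q ^ (s ℕ.* suc j) * (β j * β j ^ s)       ≈⟨ *-congʳ (trans (^-congʳ q (ℕ.*-comm s (suc j))) (sym (^-assocʳ q (suc j) s))) ⟩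
    (q ^ suc j) ^ s * (β j * β j ^ s)         ≈⟨ solve 3 (λ x y z → x :* (y :* z) := y :* (x :* z)) refl _ _ _ ⟩
    β j * ((q ^ suc j) ^ s * β j ^ s)         ≈⟨ *-congˡ (^-distrib-* (q ^ suc j) (β j) s) ⟨
    β j * (q ^ suc j * β j) ^ s               ∎
    where
    j = toℕ k

  chainSum-duality : ∀ {m} (a b : Vector ℕ (suc m)) → (∀ j → NonZero (a j)) → (∀ j → NonZero (b j)) →
    chainSum t (arguments a b) ≈
    (⊝ 1#) ^ sum (λ j → a j ℕ.+ b j) * chainSum t (arguments (reverse b) (reverse a))
  chainSum-duality a b a≢0 b≢0 with word-arguments-dual a b a≢0 b≢0
  ... | w , word≡ , dual≡ , length≡ = begin
    chainSum t (arguments a b)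
      ≈⟨ chainSum-word t t-suc (arguments-nonZero a b b≢0) word≡ ⟩
    ⟨ β ∘ toℕ , ⟦ w ⟧ 𝟏 ⟩
      ≈⟨ q-duality q Q (geo-unitʳ q {n} [p]≈0) n β [p]≈0 geo-β w ⟩
    (⊝ 1#) ^ length w * ⟨ β ∘ toℕ , ⟦ dual w ⟧ 𝟏 ⟩
      ≈⟨ *-cong sign (sym (chainSum-word t t-suc
           (arguments-nonZero (reverse b) (reverse a) (a≢0 ∘ opposite)) dual≡)) ⟩
    (⊝ 1#) ^ sum (λ j → a j ℕ.+ b j) * chainSum t (arguments (reverse b) (reverse a)) ∎
    where
    -- The exponent exceeds the length of `w` by two, and the two extra signs cancel.
    sign : (⊝ 1#) ^ length w ≈ (⊝ 1#) ^ sum (λ j → a j ℕ.+ b j)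
    sign = begin
      (⊝ 1#) ^ length w                        ≈⟨ *-identityˡ _ ⟨
      1# * (⊝ 1#) ^ length w                   ≈⟨ *-congʳ -1*-1≈1 ⟨
      ⊝ 1# * ⊝ 1# * (⊝ 1#) ^ length w          ≈⟨ *-assoc (⊝ 1#) (⊝ 1#) _ ⟩
      (⊝ 1#) ^ suc (suc (length w))            ≡⟨ ≡.cong ((⊝ 1#) ^_) length≡ ⟨
      (⊝ 1#) ^ sum (λ j → a j ℕ.+ b j)         ∎

  t-fraction : ∀ s k {g} → g ≈ geo q (suc (toℕ k)) →
               IsFraction (t s k) (q ^ ((s ∸ 1) ℕ.* suc (toℕ k))) (g ^ s)
  t-fraction s k g≈ = unit-fraction (^-unit s (trans (*-congʳ g≈) (geo-β (toℕ k) (Fin.toℕ<n k))))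

-- Rational functions represented in ℤ[q] modulo [p]_q.

[suc]q : ∀ m → [ suc m ]q ℤ[q].≈ ℤ[q].1# ℤ[q].+ q ℤ[q].* [ m ]q
[suc]q m i = ≡.trans (shifted i) (≡.sym (≡.trans (coeff-+ ℤ[q].1# (q ℤ[q].* [ m ]q) i)
  (≡.cong (λ c → ℤ[q].coeff ℤ[q].1# i ℤ.+ c) (0∷*≈ ℤ[q].1# [ m ]q ≡.refl i))))
  where
  shifted : ∀ i → ℤ[q].coeff [ suc m ]q i
                ≡ ℤ[q].coeff ℤ[q].1# i ℤ.+ ℤ[q].coeff (0ℤ ∷ ℤ[q].1# ℤ[q].* [ m ]q) i
  shifted zero    = ≡.refl
  shifted (suc i) = ≡.trans (≡.sym (CommutativeRing.*-identityˡ ℤ[q]-ring [ m ]q i))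
                            (≡.sym (ℤ.+-identityˡ _))

module ModP (n : ℕ) (prime : Prime (suc n)) where
  open RawMagmaDefs ℤ[q].*-rawMagma using (_,_)
  open Quotient ℤ[q]-ring [ suc n ]q
  open CommutativeRing quotientRing hiding (zero) renaming (_+_ to _⊕_; -_ to ⊝_)
  open RawSemiringDefs (Semiring.rawSemiring semiring) using (_^_; product)
  open Fractions quotientRing
  open QIntegers quotientRing using (geo; geo-unique)

  -- The quotient ring has the same carrier as ℤ[q], so numerators and denominators are used as its
  -- elements directly.
  Represents : RatFun → Carrier → Set
  Represents A x = IsFraction x (RatFun.num A) (RatFun.den A)

  []q≈geo : ∀ m → [ m ]q ≈ geo q m
  []q≈geo = geo-unique q [_]q refl λ m → ≈⇒∼ ([suc]q m)

  [p]≈0 : geo q (suc n) ≈ 0#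
  [p]≈0 = trans (sym ([]q≈geo (suc n))) (ℤ[q].1# , λ i → ≡.sym (CommutativeRing.*-identityˡ ℤ[q]-ring [ suc n ]q i))

  open QSums quotientRing q n prime [p]≈0

  -- The powers in `term` belong to the raw ring `ℤ[q]`, those in `t` to the quotient. The
  -- multiplications coincide, yet the powers agree only by induction on the exponent.
  ℤ[q]-^ : ∀ f m → f ℤ[q].^ m ≡ f ^ m
  ℤ[q]-^ f zero    = ≡.refl
  ℤ[q]-^ f (suc m) = ≡.cong (f *_) (ℤ[q]-^ f m)

  represents-term : ∀ s k → Represents (term s k) (t s k)
  represents-term s k = ≡.subst₂ (IsFraction (t s k))
    (≡.sym (ℤ[q]-^ q ((s ∸ 1) ℕ.* suc (toℕ k)))) (≡.sym (ℤ[q]-^ [ suc (toℕ k) ]q s))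
    (t-fraction s k ([]q≈geo (suc (toℕ k))))

  represents-product : ∀ {m} {A : Vector RatFun m} {x : Vector Carrier m} →
    (∀ i → Represents (A i) (x i)) → Represents (ℚ⟨q⟩.product A) (product x)
  represents-product {zero}  A~x = 1-fraction
  represents-product {suc m} A~x = *-fraction (A~x zero) (represents-product (A~x ∘ suc))

  represents-^ : ∀ {A x} m → Represents A x → Represents (A ℚ⟨q⟩.^ m) (x ^ m)
  represents-^ zero    A~x = 1-fraction
  represents-^ (suc m) A~x = *-fraction A~x (represents-^ m A~x)

  represents-sum : ∀ {X : Set} {A : X → RatFun} {x : X → Carrier} → (∀ i → Represents (A i) (x i)) →
    ∀ is → Represents (List.foldr ℚ⟨q⟩._+_ ℚ⟨q⟩.0# (List.map A is)) (List.foldr _⊕_ 0# (List.map x is))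
  represents-sum A~x []       = 0-fraction
  represents-sum A~x (i ∷ is) = +-fraction (A~x i) (represents-sum A~x is)

  open Sums commutativeSemiring {n} using (module ChainSum)
  open ChainSum using (chainSum)

  represents-S : ∀ s → Represents (S n s) (chainSum t s)
  represents-S s = represents-sum (λ k → represents-product (λ i → represents-term (List.lookup s i) (Vec.lookup k i)))
    (increasingTuples n (length s))

  -- The witness is A - B itself. Its denominator is a product of units modulo [p]_q, hence coprime
  -- to [p]_q; its numerator vanishes in the quotient, hence is a multiple of [p]_q.
  represents⇒≡mod : ∀ {A B x y} → Represents A x → Represents B y → x ≈ y → A ≡ B [mod [ suc n ]q ]
  represents⇒≡mod {A} {B} {x} {y} A~x B~y x≈y = record
    { f/g        = A ℚ⟨q⟩.+ (ℚ⟨q⟩.- B)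
    ; difference = λ _ → ≡.refl
    ; coprime    = unit-mod⇒coprime (IsFraction.g⁻¹ A-B~) (_∼_.multiplier (IsFraction.g*g⁻¹≈1 A-B~)) (_∼_.difference (IsFraction.g*g⁻¹≈1 A-B~))
    ; divides    = _∼_.multiplier num≈0 , λ i → ≡.sym (_∼_.difference num≈0 i)
    }
    where
    A-B~ : Represents (A ℚ⟨q⟩.+ (ℚ⟨q⟩.- B)) (x ⊕ ⊝ y)
    A-B~ = +-fraction A~x (neg-fraction B~y)
    num≈0 : RatFun.num (A ℚ⟨q⟩.+ (ℚ⟨q⟩.- B)) ≈ 0#
    num≈0 = fraction-≈0 A-B~ (trans (+-congʳ x≈y) (-‿inverseʳ y))

open import Data.Nat.Base using (_+_)

theorem7p1 : (p : ℕ) → Prime p →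
    (m : ℕ) (a b : Vector ℕ (suc m)) →
    ((j : Fin (suc m)) → NonZero (a j)) → ((j : Fin (suc m)) → NonZero (b j)) →
    S (p ∸ 1) (arguments a b)
    ≡ (ℚ⟨q⟩.- ℚ⟨q⟩.1#) ℚ⟨q⟩.^ sum (λ j → a j + b j) ℚ⟨q⟩.* S (p ∸ 1) (arguments (reverse b) (reverse a))
    [mod [ p ]q ]
theorem7p1 zero    p-prime = contradiction p-prime ¬prime[0]
theorem7p1 (suc n) p-prime m a b a≢0 b≢0 = represents⇒≡mod (represents-S (arguments a b))
  -- The sign is a power of the rational function -1/1, represented by the same power of -1 in the
  -- quotient.
  (*-fraction (represents-^ (sum λ j → a j + b j) (neg-fraction 1-fraction))
              (represents-S (arguments (reverse b) (reverse a))))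
  (chainSum-duality a b a≢0 b≢0)
  where
  open Quotient ℤ[q]-ring [ suc n ]q using (quotientRing)
  open ModP n p-prime
  open Fractions quotientRing using (*-fraction; neg-fraction; 1-fraction)
  open QSums quotientRing q n p-prime [p]≈0 using (chainSum-duality)
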